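{- Let $n$ be a positive integer and $q$ a prime power, both fixed, and let $m(n)=\left[\frac{n^2}{4}\right]+1$. For a positive integer $k$ let $C(n,k,q)$ be the total number of $k$-tuples $(A_1,\ldots,A_k)$ of pairwise commuting matrices in $M_n(\mathbb{F}_q)$. Then $C(n,k,q)$, as a function of $k$, is asymptotic to $q^{m(n)k}$ up to a constant factor: there exist constants $D_1,D_2>0$ (independent of $k$) such that $D_1q^{m(n)k}\le C(n,k,q)\le D_2 q^{m(n)k}$ for all sufficiently large $k$.
   Context: $\mathbb{F}_q$ is the finite field with $q$ elements, $M_n(\mathbb{F}_q)$ the algebra of $n\times n$ matrices over it, and $[x]$ the integer part of $x$. -}

module Defs where

open import Data.Nat as ℕ using (ℕ; zero; suc; _^_; _≤_)
open import Data.Nat.DivMod using (_/_)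
open import Data.Nat.Primality using (Prime)
open import Data.Fin using (Fin; zero; suc)
open import Data.Fin.Properties using (all?; _≟_)
open import Data.List using (List; []; _∷_; map; concatMap; filter; length; allFin)
open import Data.Product using (∃; _×_)
open import Relation.Nullary using (¬_)
open import Relation.Unary using (Decidable)
open import Relation.Binary.PropositionalEquality using (_≡_)
open import Algebra.Structures using (IsCommutativeRing)

-- A field structure on the finite set Fin q (so the field has exactly q
-- elements).  Every finite field with q elements is isomorphic to one of
-- these, and the counts below are invariant under isomorphism.
record FiniteField (q : ℕ) : Set where
  field
    _+_ _*_ : Fin q → Fin q → Fin q
    -_      : Fin q → Fin q
    0# 1#   : Fin q
    isCommutativeRing : IsCommutativeRing _≡_ _+_ _*_ -_ 0# 1#
    0≢1     : ¬ (0# ≡ 1#)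
    inverse : ∀ x → ¬ (x ≡ 0#) → ∃ λ y → (x * y) ≡ 1#

IsPrimePower : ℕ → Set
IsPrimePower q = ∃ λ p → ∃ λ e → Prime p × q ≡ p ^ suc e

m : ℕ → ℕ
m n = suc ((n ^ 2) / 4)

Matrix : ℕ → ℕ → Set
Matrix q n = Fin n → Fin n → Fin q

module _ {q : ℕ} (F : FiniteField q) where
  open FiniteField F

  sumF : ∀ {n} → (Fin n → Fin q) → Fin q
  sumF {zero}  f = 0#
  sumF {suc n} f = f zero + sumF (λ i → f (suc i))

  mulM : ∀ {n} → Matrix q n → Matrix q n → Matrix q n
  mulM A B i j = sumF (λ l → A i l * B l j)

  PairwiseCommuting : ∀ {n k} → (Fin k → Matrix q n) → Set
  PairwiseCommuting {n} {k} t =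
    ∀ i j r s → mulM (t i) (t j) r s ≡ mulM (t j) (t i) r s

  pairwiseCommuting? : ∀ {n k} → Decidable (PairwiseCommuting {n} {k})
  pairwiseCommuting? t =
    all? λ i → all? λ j → all? λ r → all? λ s →
      mulM (t i) (t j) r s ≟ mulM (t j) (t i) r s

allFuns : ∀ {A : Set} (n : ℕ) → List A → List (Fin n → A)
allFuns zero    xs = (λ ()) ∷ []
allFuns (suc n) xs =
  concatMap (λ a → map (λ f → λ { zero → a ; (suc i) → f i }) (allFuns n xs)) xs

allMatrices : (q n : ℕ) → List (Matrix q n)
allMatrices q n = allFuns n (allFuns n (allFin q))

C : ∀ {q} → FiniteField q → (n k : ℕ) → ℕ
C {q} F n k = length (filter (pairwiseCommuting? F) (allFuns k (allMatrices q n)))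

{-# OPTIONS --safe #-}
-- Upper bound.  A commuting tuple lies in its double centralizer, which is a commutative
-- algebra of matrices, and there are finitely many sets of matrices; so it suffices that a
-- commutative algebra A of n × n matrices has at most q ^ m n elements (Schur).  More
-- generally, for A-invariant S ⊆ T ⊆ Fⁿ with dim T / S ≤ d the algebra A / {a : aT ⊆ S} has
-- dimension at most m d.  This goes by induction on d as in Mirzakhani's proof of Schur's
-- theorem, except that the field is not algebraically closed, so that lines and hyperplanes
-- are replaced by a simple W / S and a U ⊇ W with U + Av = T.  Put N = {a : aT ⊆ S},
-- K₁ = {a : aT ⊆ W} and K₂ = {a : aU ⊆ S}.  By induction A / K₁ and A / K₂ have dimension at
-- most m (d - 1).  Evaluation at v embeds K₂ / N into X / S, where X = S + K₂v, while K₁ K₂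
-- maps T into S, so that K₁ / N embeds into Hom_A(T / X, W / S), which is no larger than
-- T / X.  Hence |K₁| |K₂| ≤ |N|² q ^ d, and 2 m (d - 1) + d < 2 (m d + 1).
--
-- Lower bound.  The matrices c I + B, with B supported in the upper right block of size
-- ⌊n/2⌋ × ⌈n/2⌉, commute pairwise, and there are q ^ m n of them.
module Submission where

open import Defs
open import Algebra.Bundles using (AbelianGroup)
open import Algebra.Structures using (IsAbelianGroup; module IsCommutativeRing)
import Algebra.Properties.AbelianGroup as AbelianGroupProperties
import Algebra.Properties.CommutativeSemigroup as CommutativeSemigroupProperties
open import Data.Empty using (⊥)
open import Data.Fin.Base as Fin using (Fin; zero; suc)
import Data.Fin.Properties as Fin
open import Data.List.Base
  using (List; []; _∷_; _++_; map; concatMap; filter; length; head; lookup; allFin; cartesianProduct; cartesianProductWith)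
import Data.List.Properties as List
open import Data.List.Membership.Propositional using (_∈_; lose)
open import Data.List.Membership.Propositional.Properties
  using (∈-filter⁺; ∈-filter⁻; ∈-cartesianProduct⁺; ∈-cartesianProductWith⁺; ∈-cartesianProduct⁻;
         ∈-lookup; ∈-allFin; ∈-map⁺; ∈-++⁺ˡ; ∈-++⁺ʳ)
open import Data.List.Relation.Unary.All as All using (All; []; _∷_)
open import Data.List.Relation.Unary.Any as Any using (Any; here; there; any?; index)
open import Data.List.Relation.Unary.Any.Properties using (lookup-index)
open import Data.List.Relation.Unary.AllPairs using ([]; _∷_)
open import Data.List.Relation.Unary.Unique.Propositional using (Unique)
import Data.List.Relation.Unary.Unique.Propositional.Properties as Unique
open import Data.Maybe.Base using (fromMaybe)
open import Data.Nat.Base as ℕ using (ℕ; zero; suc; _^_; _*_; _≥_; NonZero; z≤n; s≤s)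
import Data.Nat.Properties as ℕ
open import Data.Nat.DivMod using (m*n/n≡m; +-distrib-/-∣ˡ)
open import Data.Nat.Divisibility using (n∣m*n)
open import Data.Nat.Solver using (module +-*-Solver)
open import Data.Product.Base using (Σ; ∃; _×_; _,_; proj₁; proj₂)
open import Data.Sum.Base as Sum using (_⊎_; inj₁; inj₂)
open import Data.Unit.Base using (⊤; tt)
open import Data.Vec.Base as Vec using (Vec; []; _∷_)
import Data.Vec.Properties as Vec
open import Function.Base using (_∘_; id)
open import Relation.Nullary using (¬_; Dec; yes; no; contradiction)
open import Relation.Nullary.Decidable using (map′; _×-dec_; _⊎-dec_; _→-dec_; ¬?; decidable-stable)
open import Relation.Unary using (Decidable)
open import Relation.Binary.Definitions using (DecidableEquality)
open import Relation.Binary.PropositionalEquality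
open import Relation.Binary.PropositionalEquality.Algebra using (isMagma)

-- Counting in lists

lookup-injective : ∀ {A : Set} {xs : List A} → Unique xs →
                   ∀ i j → lookup xs i ≡ lookup xs j → i ≡ j
lookup-injective (_   ∷ _)   zero    zero    _  = refl
lookup-injective {xs = _ ∷ xs} (x∉ ∷ _) zero (suc j) eq =
  contradiction eq (All.lookup x∉ (∈-lookup {xs = xs} j))
lookup-injective {xs = _ ∷ xs} (x∉ ∷ _) (suc i) zero eq =
  contradiction (sym eq) (All.lookup x∉ (∈-lookup {xs = xs} i))
lookup-injective (_   ∷ xs!) (suc i) (suc j) eq = cong suc (lookup-injective xs! i j eq)

-- Positions in xs are sent to positions in ys, which reduces the claim to the pigeonhole principle
-- on `Fin`. Injectivity is asked on members of xs only, since the maps used later are injective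
-- only on given subspaces.
injection⇒length≤ : ∀ {A B : Set} {xs : List A} {ys : List B} (f : A → B) → Unique xs →
                    (∀ {x} → x ∈ xs → f x ∈ ys) →
                    (∀ {x y} → x ∈ xs → y ∈ xs → f x ≡ f y → x ≡ y) →
                    length xs ℕ.≤ length ys
injection⇒length≤ {xs = xs} {ys} f xs! f∈ f-inj = Fin.injective⇒≤ {f = g} g-inj
  where
  ∈f : ∀ i → f (lookup xs i) ∈ ys
  ∈f i = f∈ (∈-lookup i)
  g : Fin (length xs) → Fin (length ys)
  g i = index (∈f i)
  g-inj : ∀ {i j} → g i ≡ g j → i ≡ j
  g-inj {i} {j} eq = lookup-injective xs! i j (f-inj (∈-lookup i) (∈-lookup j) (begin
    f (lookup xs i)    ≡⟨ lookup-index (∈f i) ⟩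
    lookup ys (g i)    ≡⟨ cong (lookup ys) eq ⟩
    lookup ys (g j)    ≡⟨ lookup-index (∈f j) ⟨
    f (lookup xs j)    ∎))
    where open ≡-Reasoning

length-cartesianProductWith : ∀ {A B C : Set} (f : A → B → C) xs ys →
                              length (cartesianProductWith f xs ys) ≡ length xs * length ys
length-cartesianProductWith f []       ys = refl
length-cartesianProductWith f (x ∷ xs) ys =
  trans (List.length-++ (map (f x) ys))
        (cong₂ ℕ._+_ (List.length-map (f x) ys) (length-cartesianProductWith f xs ys))

module _ {A : Set} where

  length-filter-mono : ∀ {P Q : A → Set} (P? : Decidable P) (Q? : Decidable Q) → (∀ x → P x → Q x) →
                       ∀ xs → length (filter P? xs) ℕ.≤ length (filter Q? xs)
  length-filter-mono P? Q? P⇒Q []       = z≤n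
  length-filter-mono P? Q? P⇒Q (x ∷ xs) with P? x | Q? x
  ... | yes _  | yes _  = s≤s (length-filter-mono P? Q? P⇒Q xs)
  ... | yes px | no ¬qx = contradiction (P⇒Q x px) ¬qx
  ... | no _   | yes _  = ℕ.m≤n⇒m≤1+n (length-filter-mono P? Q? P⇒Q xs)
  ... | no _   | no _   = length-filter-mono P? Q? P⇒Q xs

  length-filter-⊎ : ∀ {P Q R : A → Set} (P? : Decidable P) (Q? : Decidable Q) (R? : Decidable R) →
                    (∀ x → P x → Q x ⊎ R x) →
                    ∀ xs → length (filter P? xs) ℕ.≤ length (filter Q? xs) ℕ.+ length (filter R? xs)
  length-filter-⊎ P? Q? R? P⇒Q⊎R []       = z≤n
  length-filter-⊎ P? Q? R? P⇒Q⊎R (x ∷ xs) with ih ← length-filter-⊎ P? Q? R? P⇒Q⊎R xs | P? x | Q? x | R? x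
  ... | yes _  | yes _  | yes _  = s≤s (ℕ.≤-trans ih (ℕ.+-monoʳ-≤ _ (ℕ.n≤1+n _)))
  ... | yes _  | yes _  | no _   = s≤s ih
  ... | yes _  | no _   | yes _  = ℕ.≤-trans (s≤s ih) (ℕ.≤-reflexive (sym (ℕ.+-suc _ _)))
  ... | yes px | no ¬qx | no ¬rx with P⇒Q⊎R x px
  ...   | inj₁ qx = contradiction qx ¬qx
  ...   | inj₂ rx = contradiction rx ¬rx
  length-filter-⊎ P? Q? R? P⇒Q⊎R (x ∷ xs) | no _ | yes _ | yes _ = ℕ.m≤n⇒m≤1+n (ℕ.≤-trans ih (ℕ.+-monoʳ-≤ _ (ℕ.n≤1+n _)))
  length-filter-⊎ P? Q? R? P⇒Q⊎R (x ∷ xs) | no _ | yes _ | no _  = ℕ.m≤n⇒m≤1+n ih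
  length-filter-⊎ P? Q? R? P⇒Q⊎R (x ∷ xs) | no _ | no _  | yes _ = ℕ.≤-trans ih (ℕ.+-monoʳ-≤ _ (ℕ.n≤1+n _))
  length-filter-⊎ P? Q? R? P⇒Q⊎R (x ∷ xs) | no _ | no _  | no _  = ih

  -- The union bound. It is applied with j running over sets of matrices and x over k-tuples.
  length-filter-⋃ : ∀ {J : Set} {Q : J → A → Set} (Q? : ∀ j → Decidable (Q j)) {c} xs →
                    (∀ j → length (filter (Q? j) xs) ℕ.≤ c) →
                    ∀ js → length (filter (λ x → any? (λ j → Q? j x) js) xs) ℕ.≤ length js * c
  length-filter-⋃ Q? xs ≤c [] =
    ℕ.≤-reflexive (cong length (List.filter-none (λ x → any? (λ j → Q? j x) []) (All.universal (λ _ ()) xs)))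
  length-filter-⋃ Q? xs ≤c (j ∷ js) = ℕ.≤-trans
    (length-filter-⊎ _ (Q? j) (λ x → any? (λ j → Q? j x) js) (λ { x (here qx) → inj₁ qx ; x (there qx) → inj₂ qx }) xs)
    (ℕ.+-mono-≤ (≤c j) (length-filter-⋃ Q? xs ≤c js))

  sublists : List A → List (List A)
  sublists []       = [] ∷ []
  sublists (x ∷ xs) = map (x ∷_) (sublists xs) ++ sublists xs

  -- Every decidable set is represented in `sublists`, which thus serves as a finite index set for
  -- the union bound; for sets of matrices it does not depend on k.
  filter∈sublists : ∀ {P : A → Set} (P? : Decidable P) xs → filter P? xs ∈ sublists xs
  filter∈sublists P? []       = here refl
  filter∈sublists P? (x ∷ xs) with P? x
  ... | yes _ = ∈-++⁺ˡ (∈-map⁺ (x ∷_) (filter∈sublists P? xs))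
  ... | no _  = ∈-++⁺ʳ (map (x ∷_) (sublists xs)) (filter∈sublists P? xs)

-- Enumerations of tuples and vectors

length-filter-map : ∀ {A B : Set} (f : A → B) {P : B → Set} (P? : Decidable P) xs →
                    length (filter P? (map f xs)) ≡ length (filter (P? ∘ f) xs)
length-filter-map f P? []       = refl
length-filter-map f P? (x ∷ xs) with P? (f x)
... | yes _ = cong suc (length-filter-map f P? xs)
... | no _  = length-filter-map f P? xs

-- The operation cons stands for the anonymous function in the definition of allFuns.
module _ {A : Set} {k : ℕ} (cons : A → (Fin k → A) → Fin (suc k) → A)
         (cons-zero : ∀ a f → cons a f zero ≡ a) (cons-suc : ∀ a f i → cons a f (suc i) ≡ f i) where

  length-filter-cons : ∀ {Q : A → Set} (Q? : Decidable Q) fs xs →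
    length (filter (λ t → Fin.all? (λ i → Q? (t i))) (concatMap (λ a → map (cons a) fs) xs)) ≡
    length (filter Q? xs) * length (filter (λ t → Fin.all? (λ i → Q? (t i))) fs)
  length-filter-cons         Q? fs []       = refl
  length-filter-cons {Q = Q} Q? fs (a ∷ xs) = begin
    length (filter Qs? (map (cons a) fs ++ rest))
      ≡⟨ cong length (List.filter-++ Qs? (map (cons a) fs) rest) ⟩
    length (filter Qs? (map (cons a) fs) ++ filter Qs? rest)
      ≡⟨ List.length-++ (filter Qs? (map (cons a) fs)) ⟩
    length (filter Qs? (map (cons a) fs)) ℕ.+ length (filter Qs? rest)
      ≡⟨ cong₂ ℕ._+_ (length-filter-map (cons a) Qs? fs) (length-filter-cons Q? fs xs) ⟩
    length (filter (Qs? ∘ cons a) fs) ℕ.+ length (filter Q? xs) * N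
      ≡⟨ first ⟩
    length (filter Q? (a ∷ xs)) * N
      ∎
    where
    open ≡-Reasoning
    Qs? : ∀ {k} → Decidable (λ (t : Fin k → A) → ∀ i → Q (t i))
    Qs? t = Fin.all? (λ i → Q? (t i))
    rest = concatMap (λ a → map (cons a) fs) xs
    N = length (filter Qs? fs)
    first : length (filter (Qs? ∘ cons a) fs) ℕ.+ length (filter Q? xs) * N ≡ length (filter Q? (a ∷ xs)) * N
    first with Q? a
    ... | yes qa = cong (λ l → length l ℕ.+ length (filter Q? xs) * N) (List.filter-≐ (Qs? ∘ cons a) Qs?
      ( (λ {f} q i → subst Q (cons-suc a f i) (q (suc i)))
      , (λ {f} q → λ { zero → subst Q (sym (cons-zero a f)) qa ; (suc i) → subst Q (sym (cons-suc a f i)) (q i) })) fs)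
    ... | no ¬qa = cong (λ l → length l ℕ.+ length (filter Q? xs) * N) (List.filter-none (Qs? ∘ cons a)
      (All.universal (λ f q → ¬qa (subst Q (cons-zero a f) (q zero))) fs))

  map-tabulate-cons : ∀ {B : Set} (h : A → B) fs xs →
    map (λ f → Vec.tabulate (h ∘ f)) (concatMap (λ a → map (cons a) fs) xs) ≡
    cartesianProductWith _∷_ (map h xs) (map (λ f → Vec.tabulate (h ∘ f)) fs)
  map-tabulate-cons h fs []       = refl
  map-tabulate-cons h fs (a ∷ xs) = trans (List.map-++ _ (map (cons a) fs) _) (cong₂ _++_
    (trans (sym (List.map-∘ fs)) (trans (List.map-cong
      (λ f → cong₂ _∷_ (cong h (cons-zero a f)) (Vec.tabulate-cong λ i → cong h (cons-suc a f i))) fs) (List.map-∘ fs)))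
    (map-tabulate-cons h fs xs))

-- Coordinates are chosen independently, so a condition on each of them contributes a k-th power. In
-- both bounds the exponential dependence on k comes from here.
length-filter-allFuns : ∀ {A : Set} {Q : A → Set} (Q? : Decidable Q) k xs →
  length (filter (λ t → Fin.all? (λ i → Q? (t i))) (allFuns k xs)) ≡ length (filter Q? xs) ^ k
length-filter-allFuns Q? zero    xs = refl
length-filter-allFuns Q? (suc k) xs =
  trans (length-filter-cons _ (λ _ _ → refl) (λ _ _ _ → refl) Q? (allFuns k xs) xs)
        (cong (length (filter Q? xs) *_) (length-filter-allFuns Q? k xs))

-- Vectors stand in for functions on `Fin n`: entrywise equal vectors are propositionally equal, as
-- membership in lists and uniqueness require.
vectors : ∀ {A : Set} n → List A → List (Vec A n)
vectors zero    xs = [] ∷ []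
vectors (suc n) xs = cartesianProductWith _∷_ xs (vectors n xs)

∈-vectors : ∀ {A : Set} {xs : List A} → (∀ x → x ∈ xs) → ∀ {n} (v : Vec A n) → v ∈ vectors n xs
∈-vectors ∈xs []      = here refl
∈-vectors ∈xs (x ∷ v) = ∈-cartesianProductWith⁺ _∷_ (∈xs x) (∈-vectors ∈xs v)

vectors-unique : ∀ {A : Set} {xs : List A} n → Unique xs → Unique (vectors n xs)
vectors-unique zero    xs! = [] ∷ []
vectors-unique (suc n) xs! = Unique.cartesianProductWith⁺ _∷_ Vec.∷-injective xs! (vectors-unique n xs!)

length-vectors : ∀ {A : Set} n (xs : List A) → length (vectors n xs) ≡ length xs ^ n
length-vectors zero    xs = refl
length-vectors (suc n) xs =
  trans (length-cartesianProductWith _∷_ xs (vectors n xs)) (cong (length xs *_) (length-vectors n xs))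

map-tabulate-allFuns : ∀ {A B : Set} (h : A → B) n xs →
                       map (λ f → Vec.tabulate (h ∘ f)) (allFuns n xs) ≡ vectors n (map h xs)
map-tabulate-allFuns h zero    xs = refl
map-tabulate-allFuns h (suc n) xs =
  trans (map-tabulate-cons _ (λ _ _ → refl) (λ _ _ _ → refl) h (allFuns n xs) xs)
        (cong (cartesianProductWith _∷_ (map h xs)) (map-tabulate-allFuns h n xs))

-- Arithmetic of `m`

halves : ∀ n → ∃ λ h → n ≡ h ℕ.+ h ⊎ n ≡ h ℕ.+ suc h
halves zero = 0 , inj₁ refl
halves (suc n) with halves n
... | h , inj₁ n≡ = h , inj₂ (trans (cong suc n≡) (sym (ℕ.+-suc h h)))
... | h , inj₂ n≡ = suc h , inj₁ (cong suc n≡)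

m-even : ∀ h → m (h ℕ.+ h) ≡ suc (h * h)
m-even h = cong suc (trans
  (cong (ℕ._/ 4) (solve 1 (λ h → (h :+ h) :^ 2 := (h :* h) :* con 4) refl h))
  (m*n/n≡m (h * h) 4))
  where open +-*-Solver

-- The square is 4h(h + 1) + 1, and the remainder 1 disappears in the division by 4.
m-odd : ∀ h → m (h ℕ.+ suc h) ≡ suc (h * suc h)
m-odd h = cong suc (trans
  (cong (ℕ._/ 4) (solve 1 (λ h → (h :+ (con 1 :+ h)) :^ 2 := (h :* (con 1 :+ h)) :* con 4 :+ con 1) refl h))
  (trans (+-distrib-/-∣ˡ {h * suc h * 4} 1 {4} (n∣m*n (h * suc h)))
         (trans (ℕ.+-identityʳ _) (m*n/n≡m (h * suc h) 4))))
  where open +-*-Solver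

-- Settles the case of Schur's bound where T / S is simple: there the algebra embeds into T / S, so
-- its dimension is at most d.
n≤m[n] : ∀ n → n ℕ.≤ m n
n≤m[n] n with halves n
... | zero  , inj₁ refl = z≤n
... | suc zero , inj₁ refl = ℕ.≤-refl
... | suc (suc h) , inj₁ refl rewrite m-even (2 ℕ.+ h) = subst (2 ℕ.+ h ℕ.+ (2 ℕ.+ h) ℕ.≤_)
  (solve 1 (λ h → (con 2 :+ h :+ (con 2 :+ h)) :+ (h :* h :+ con 2 :* h :+ con 1) := con 1 :+ (con 2 :+ h) :* (con 2 :+ h)) refl h)
  (ℕ.m≤m+n _ _)
  where open +-*-Solver
... | zero , inj₂ refl = ℕ.≤-refl
... | suc h , inj₂ refl rewrite m-odd (suc h) = subst (suc h ℕ.+ (2 ℕ.+ h) ℕ.≤_)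
  (solve 1 (λ h → (con 1 :+ h :+ (con 2 :+ h)) :+ (h :* h :+ h) := con 1 :+ (con 1 :+ h) :* (con 2 :+ h)) refl h)
  (ℕ.m≤m+n _ _)
  where open +-*-Solver

-- The sides differ by 1 for even d and by 2 for odd d. For even d the left side exceeds 2 m (d + 1)
-- by 1, so the induction closes only because dimensions are integers; hence the extra `suc` in each
-- summand on the right.
m-step : ∀ d → m d ℕ.+ m d ℕ.+ suc d ℕ.< suc (m (suc d)) ℕ.+ suc (m (suc d))
m-step d with halves d
... | h , inj₁ refl = subst₂ ℕ._<_
  (cong (λ x → x ℕ.+ x ℕ.+ suc (h ℕ.+ h)) (sym (m-even h)))
  (cong (λ x → suc x ℕ.+ suc x) (trans (sym (m-odd h)) (cong m (ℕ.+-suc h h))))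
  (ℕ.≤-reflexive (solve 1 (λ h → con 1 :+ (con 1 :+ h :* h :+ (con 1 :+ h :* h) :+ (con 1 :+ (h :+ h))) :=
    (con 2 :+ h :* (con 1 :+ h)) :+ (con 2 :+ h :* (con 1 :+ h))) refl h))
  where open +-*-Solver
... | h , inj₂ refl = subst₂ ℕ._<_
  (cong (λ x → x ℕ.+ x ℕ.+ suc (h ℕ.+ suc h)) (sym (m-odd h)))
  (cong (λ x → suc x ℕ.+ suc x) (sym (m-even (suc h))))
  (ℕ.≤-trans (ℕ.n≤1+n _) (ℕ.≤-reflexive (solve 1 (λ h →
    con 2 :+ (con 1 :+ h :* (con 1 :+ h) :+ (con 1 :+ h :* (con 1 :+ h)) :+ (con 1 :+ (h :+ (con 1 :+ h)))) :=
    (con 2 :+ (con 1 :+ h) :* (con 1 :+ h)) :+ (con 2 :+ (con 1 :+ h) :* (con 1 :+ h))) refl h)))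
  where open +-*-Solver

-- Finite vector spaces and indices of subspaces

module LinearAlgebra {q : ℕ} (F : FiniteField q) where

  private module F where
    open FiniteField F public renaming (_+_ to infixl 6 _+_; _*_ to infixl 7 _*_)
    open IsCommutativeRing isCommutativeRing public
      hiding (refl; sym; trans; reflexive; isEquivalence; setoid; isPartialEquivalence)

  -- A finite vector space together with an enumeration without repetitions. Sizes take the place of
  -- dimensions throughout, and quantifiers over the space are decidable.
  record Space : Set₁ where
    infixl 6 _+_ _-_
    infixr 7 _·_
    field
      Carrier        : Set
      _+_            : Carrier → Carrier → Carrier
      0#             : Carrier
      neg            : Carrier → Carrier
      isAbelianGroup : IsAbelianGroup _≡_ _+_ 0# neg
      _·_            : Fin q → Carrier → Carrier
      ·-distribˡ     : ∀ c x y → c · (x + y) ≡ c · x + c · y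
      ·-distribʳ     : ∀ c d x → (c F.+ d) · x ≡ c · x + d · x
      ·-assoc        : ∀ c d x → (c F.* d) · x ≡ c · d · x
      ·-identity     : ∀ x → F.1# · x ≡ x
      _≟_            : DecidableEquality Carrier
      elements       : List Carrier
      complete       : ∀ x → x ∈ elements
      unique         : Unique elements

    abelianGroup : AbelianGroup _ _
    abelianGroup = record { isAbelianGroup = isAbelianGroup }

    open IsAbelianGroup isAbelianGroup public
      using (assoc; comm; identityˡ; identityʳ; inverseˡ; inverseʳ)
    open AbelianGroupProperties abelianGroup public
      using (identityʳ-unique; inverseˡ-unique; ε⁻¹≈ε; ⁻¹-involutive; ⁻¹-∙-comm; x∙y⁻¹≈ε⇒x≈y)
      renaming (∙-cancelˡ to +-cancelˡ)
    open CommutativeSemigroupProperties (AbelianGroup.commutativeSemigroup abelianGroup) public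
      using (interchange)

    _-_ : Carrier → Carrier → Carrier
    x - y = x + neg y

    x-y+y : ∀ x y → x - y + y ≡ x
    x-y+y x y = trans (assoc x (neg y) y) (trans (cong (x +_) (inverseˡ y)) (identityʳ x))

    x-0 : ∀ x → x - 0# ≡ x
    x-0 x = trans (cong (x +_) ε⁻¹≈ε) (identityʳ x)

    minus-interchange : ∀ w x y z → (w - x) - (y - z) ≡ (w - y) - (x - z)
    minus-interchange w x y z = begin
      (w - x) - (y - z)              ≡⟨ cong (w - x +_) (⁻¹-∙-comm y (neg z)) ⟨
      (w + neg x) + (neg y - neg z)  ≡⟨ interchange w (neg x) (neg y) (neg (neg z)) ⟩
      (w - y) + (neg x - neg z)      ≡⟨ cong (w - y +_) (⁻¹-∙-comm x (neg z)) ⟩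
      (w - y) - (x - z)              ∎
      where open ≡-Reasoning

    +-minus-interchange : ∀ w x y z → (w + x) - (y + z) ≡ (w - y) + (x - z)
    +-minus-interchange w x y z =
      trans (cong (w + x +_) (sym (⁻¹-∙-comm y z))) (interchange w x (neg y) (neg z))

    +≡+⇒-≡- : ∀ {w x y z} → w + x ≡ y + z → w - y ≡ z - x
    +≡+⇒-≡- {w} {x} {y} {z} eq = begin
      w - y              ≡⟨ identityʳ _ ⟨
      (w - y) + 0#       ≡⟨ cong (w - y +_) (inverseʳ x) ⟨
      (w - y) + (x - x)  ≡⟨ +-minus-interchange w x y x ⟨
      (w + x) - (y + x)  ≡⟨ cong (_- (y + x)) eq ⟩
      (y + z) - (y + x)  ≡⟨ +-minus-interchange y z y x ⟩
      (y - y) + (z - x)  ≡⟨ cong (_+ (z - x)) (inverseʳ y) ⟩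
      0# + (z - x)       ≡⟨ identityˡ _ ⟩
      z - x              ∎
      where open ≡-Reasoning

    any∃? : ∀ {P : Carrier → Set} → Decidable P → Dec (∃ P)
    any∃? P? = map′ Any.satisfied (λ (x , px) → lose (complete x) px) (any? P? elements)

    all∀? : ∀ {P : Carrier → Set} → Decidable P → Dec (∀ x → P x)
    all∀? P? = map′ (λ ps x → All.lookup ps (complete x)) (λ f → All.tabulate λ {x} _ → f x)
                    (All.all? P? elements)

    count : ∀ {P : Carrier → Set} → Decidable P → ℕ
    count P? = length (filter P? elements)

    -- The fallback 0# is returned only when nothing satisfies P.
    choose : ∀ {P : Carrier → Set} → Decidable P → Carrier
    choose P? = fromMaybe 0# (head (filter P? elements))

    choose-satisfies : ∀ {P : Carrier → Set} (P? : Decidable P) → ∃ P → P (choose P?)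
    choose-satisfies {P} P? (x , px) = go (filter P? elements) (∈-filter⁺ P? (complete x) px)
                                       (proj₂ ∘ ∈-filter⁻ P? {xs = elements})
      where
      go : ∀ xs → x ∈ xs → (∀ {y} → y ∈ xs → P y) → P (fromMaybe 0# (head xs))
      go (_ ∷ _) _ P[xs] = P[xs] (here refl)

    -- Makes `choose` a function of the set rather than of the predicate describing it, so that it
    -- can pick one representative for each coset.
    choose-cong : ∀ {P Q : Carrier → Set} (P? : Decidable P) (Q? : Decidable Q) →
                  (∀ {x} → P x → Q x) → (∀ {x} → Q x → P x) → choose P? ≡ choose Q?
    choose-cong P? Q? P⇒Q Q⇒P =
      cong (fromMaybe 0# ∘ head) (List.filter-≐ P? Q? (P⇒Q , Q⇒P) elements)

  open Space using () renaming (Carrier to ∣_∣)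

  record Linear (X Y : Space) : Set where
    private
      module X = Space X
      module Y = Space Y
    field
      fun     : ∣ X ∣ → ∣ Y ∣
      +-homo  : ∀ x y → fun (x X.+ y) ≡ fun x Y.+ fun y
      ·-homo  : ∀ c x → fun (c X.· x) ≡ c Y.· fun x

    0-homo : fun X.0# ≡ Y.0#
    0-homo = Y.identityʳ-unique (fun X.0#) (fun X.0#)
      (trans (sym (+-homo X.0# X.0#)) (cong fun (X.identityˡ X.0#)))

    minus-homo : ∀ x y → fun (x X.- y) ≡ fun x Y.- fun y
    minus-homo x y = trans (+-homo x (X.neg y)) (cong (fun x Y.+_)
      (Y.inverseˡ-unique _ _ (trans (sym (+-homo (X.neg y) y)) (trans (cong fun (X.inverseˡ y)) 0-homo))))

  𝔽 : Space
  𝔽 = record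
    { Carrier        = Fin q
    ; _+_            = F._+_
    ; 0#             = F.0#
    ; neg            = F.-_
    ; isAbelianGroup = F.+-isAbelianGroup
    ; _·_            = F._*_
    ; ·-distribˡ     = F.distribˡ
    ; ·-distribʳ     = λ c d x → F.distribʳ x c d
    ; ·-assoc        = F.*-assoc
    ; ·-identity     = F.*-identityˡ
    ; _≟_            = Fin._≟_
    ; elements       = allFin q
    ; complete       = ∈-allFin
    ; unique         = Unique.allFin⁺ q
    }

  record Subspace (X : Space) : Set₁ where
    private module X = Space X
    infix 4 _∋_ _∋?_
    field
      _∋_  : ∣ X ∣ → Set
      _∋?_ : Decidable _∋_
      ∋-0  : _∋_ X.0#
      ∋-minus  : ∀ {x y} → _∋_ x → _∋_ y → _∋_ (x X.- y)
      ∋-·  : ∀ c {x} → _∋_ x → _∋_ (c X.· x)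

    ∋-neg : ∀ {x} → _∋_ x → _∋_ (X.neg x)
    ∋-neg x∈ = subst _∋_ (X.identityˡ _) (∋-minus ∋-0 x∈)

    ∋-+ : ∀ {x y} → _∋_ x → _∋_ y → _∋_ (x X.+ y)
    ∋-+ x∈ y∈ = subst _∋_ (cong (_ X.+_) (X.⁻¹-involutive _)) (∋-minus x∈ (∋-neg y∈))

    ∋-cancel : ∀ {x y} → _∋_ (x X.- y) → _∋_ y → _∋_ x
    ∋-cancel x-y∈ y∈ = subst _∋_ (X.x-y+y _ _) (∋-+ x-y∈ y∈)

    ∋-swap : ∀ {x y} → _∋_ (x X.- y) → _∋_ (y X.- x)
    ∋-swap {x} {y} x-y∈ = subst _∋_ eq (∋-neg x-y∈)
      where
      eq : X.neg (x X.- y) ≡ y X.- x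
      eq = trans (sym (X.⁻¹-∙-comm x (X.neg y)))
          (trans (X.comm _ _) (cong (X._- x) (X.⁻¹-involutive y)))

    ∋-trans : ∀ {x y z} → _∋_ (x X.- y) → _∋_ (y X.- z) → _∋_ (x X.- z)
    ∋-trans {x} {y} {z} x-y∈ y-z∈ = subst _∋_ eq (∋-+ x-y∈ y-z∈)
      where
      eq : (x X.- y) X.+ (y X.- z) ≡ x X.- z
      eq = trans (sym (X.assoc _ y (X.neg z))) (cong (X._- z) (X.x-y+y x y))

    size : ℕ
    size = X.count _∋?_

  open Subspace using (_∋_; _∋?_; ∋-0; ∋-minus; ∋-+; ∋-·; ∋-neg; ∋-cancel; ∋-swap; ∋-trans; size)

  infix 4 _⊆_ _⊆?_
  _⊆_ : ∀ {X} → Subspace X → Subspace X → Set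
  P ⊆ Q = ∀ x → P ∋ x → Q ∋ x

  _⊆?_ : ∀ {X} (P Q : Subspace X) → Dec (P ⊆ Q)
  _⊆?_ {X} P Q = Space.all∀? X λ x → (P ∋? x) →-dec (Q ∋? x)

  ⊈⇒∃ : ∀ {X} (P Q : Subspace X) → ¬ P ⊆ Q → ∃ λ x → P ∋ x × ¬ Q ∋ x
  ⊈⇒∃ {X} P Q P⊈Q = decidable-stable (Space.any∃? X λ x → (P ∋? x) ×-dec ¬? (Q ∋? x))
    λ ∄ → P⊈Q λ x x∈P → decidable-stable (Q ∋? x) λ x∉Q → ∄ (x , x∈P , x∉Q)

  module _ {X : Space} where
    open Space X

    0-subspace : Subspace X
    0-subspace = record
      { _∋_  = _≡ 0#
      ; _∋?_ = _≟ 0#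
      ; ∋-0  = refl
      ; ∋-minus  = λ { refl refl → x-0 0# }
      ; ∋-·  = λ { c refl → identityʳ-unique _ _
                 (trans (sym (·-distribˡ c 0# 0#)) (cong (c ·_) (identityˡ 0#))) }
      }

    full : Subspace X
    full = record
      { _∋_ = λ _ → ⊤ ; _∋?_ = λ _ → yes tt ; ∋-0 = tt ; ∋-minus = λ _ _ → tt ; ∋-· = λ _ _ → tt }

    size-full : size full ≡ length elements
    size-full = cong length (List.filter-all (λ _ → yes tt) (All.universal (λ _ → tt) elements))

    size-positive : (P : Subspace X) → 1 ℕ.≤ size P
    size-positive P = List.filter-some (P ∋?_) (lose (complete 0#) (∋-0 P))

    size-mono : (P Q : Subspace X) → P ⊆ Q → size P ℕ.≤ size Q
    size-mono P Q P⊆Q = injection⇒length≤ id (Unique.filter⁺ (P ∋?_) unique)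
      (λ x∈ → ∈-filter⁺ (Q ∋?_) (complete _) (P⊆Q _ (proj₂ (∈-filter⁻ (P ∋?_) {xs = elements} x∈))))
      (λ _ _ eq → eq)

    size-0 : (P : Subspace X) → (∀ x → P ∋ x → x ≡ 0#) → size P ℕ.≤ 1
    size-0 P P⊆0 = injection⇒length≤ {ys = 0# ∷ []} id (Unique.filter⁺ (P ∋?_) unique)
      (λ x∈ → here (P⊆0 _ (proj₂ (∈-filter⁻ (P ∋?_) {xs = elements} x∈))))
      (λ _ _ eq → eq)

  -- τ induces an injection of P / K into Q / R.
  quotient-size : ∀ {X Y} (P K : Subspace X) (Q R : Subspace Y) → K ⊆ P → R ⊆ Q →
                  (τ : ∣ X ∣ → ∣ Y ∣) → (∀ x → P ∋ x → Q ∋ τ x) →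
                  (∀ x x′ → P ∋ x → P ∋ x′ → R ∋ (Space._-_ Y (τ x) (τ x′)) → K ∋ (Space._-_ X x x′)) →
                  size P * size R ℕ.≤ size K * size Q
  quotient-size {X} {Y} P K Q R K⊆P R⊆Q τ τ∈ τ-inj =
    subst₂ ℕ._≤_ (length-cartesianProductWith _,_ ps rs) (length-cartesianProductWith _,_ ks qs)
      (injection⇒length≤ g (Unique.cartesianProduct⁺ (Unique.filter⁺ (P ∋?_) X.unique)
                                                     (Unique.filter⁺ (R ∋?_) Y.unique))
        (λ {x} x∈ → let p∈ , r∈ = split {x} x∈ in
          ∈-cartesianProduct⁺ (∈-filter⁺ (K ∋?_) (X.complete _) (∋-swap K (rep-∼ _)))
            (∈-filter⁺ (Q ∋?_) (Y.complete _) (∋-+ Q (τ∈ _ (rep∈P p∈)) (R⊆Q _ r∈))))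
        (λ {x} {y} x∈ y∈ → g-inj (split {x} x∈) (split {y} y∈)))
    where
    module X = Space X
    module Y = Space Y
    ps = filter (P ∋?_) X.elements
    ks = filter (K ∋?_) X.elements
    qs = filter (Q ∋?_) Y.elements
    rs = filter (R ∋?_) Y.elements
    rep : X.Carrier → X.Carrier
    rep x = X.choose λ z → K ∋? (z X.- x)
    rep-∼ : ∀ x → K ∋ (rep x X.- x)
    rep-∼ x = X.choose-satisfies (λ z → K ∋? (z X.- x)) (x , subst (K ∋_) (sym (X.inverseʳ x)) (∋-0 K))
    rep-cong : ∀ {x y} → K ∋ (x X.- y) → rep x ≡ rep y
    rep-cong x∼y = X.choose-cong _ _ (λ z∼x → ∋-trans K z∼x x∼y) (λ z∼y → ∋-trans K z∼y (∋-swap K x∼y))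
    rep∈P : ∀ {x} → P ∋ x → P ∋ rep x
    rep∈P x∈ = ∋-cancel P (K⊆P _ (rep-∼ _)) x∈
    -- An injection of P × R into K × Q avoids forming quotients. As τ need not be constant on
    -- cosets of K, it is taken at the chosen representative. The second component modulo R
    -- determines that representative, after which p and r can be recovered.
    g : X.Carrier × Y.Carrier → X.Carrier × Y.Carrier
    g (p , r) = p X.- rep p , τ (rep p) Y.+ r
    split : ∀ {x} → x ∈ cartesianProduct ps rs → P ∋ proj₁ x × R ∋ proj₂ x
    split x∈ with p∈ , r∈ ← ∈-cartesianProduct⁻ ps rs x∈ =
      proj₂ (∈-filter⁻ (P ∋?_) {xs = X.elements} p∈) , proj₂ (∈-filter⁻ (R ∋?_) {xs = Y.elements} r∈)
    g-inj : ∀ {x y} → P ∋ proj₁ x × R ∋ proj₂ x → P ∋ proj₁ y × R ∋ proj₂ y → g x ≡ g y → x ≡ y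
    g-inj {p , r} {p′ , r′} (p∈ , r∈) (p′∈ , r′∈) eq = cong₂ _,_ p≡p′ r≡r′
      where
      eq₁ = cong proj₁ eq
      eq₂ = cong proj₂ eq
      t = τ (rep p)
      t′ = τ (rep p′)
      t∼t′ : R ∋ (t Y.- t′)
      t∼t′ = subst (R ∋_) (sym (Y.+≡+⇒-≡- eq₂)) (∋-minus R r′∈ r∈)
      reps∼ : K ∋ (rep p X.- rep p′)
      reps∼ = τ-inj _ _ (rep∈P p∈) (rep∈P p′∈) t∼t′
      reps≡ : rep p ≡ rep p′
      reps≡ = rep-cong (∋-trans K (∋-swap K (rep-∼ p)) (∋-trans K reps∼ (rep-∼ p′)))
      p≡p′ : p ≡ p′
      p≡p′ = trans (sym (X.x-y+y p (rep p))) (trans (cong₂ X._+_ eq₁ reps≡) (X.x-y+y p′ (rep p′)))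
      r≡r′ : r ≡ r′
      r≡r′ = Y.+-cancelˡ t r r′ (trans eq₂ (cong (λ z → τ z Y.+ r′) (sym reps≡)))

  module _ {X : Space} where
    open Space X

    scale : Fin q → Linear X X
    scale c = record
      { fun    = c ·_
      ; +-homo = ·-distribˡ c
      ; ·-homo = λ d x → trans (sym (·-assoc c d x)) (trans (cong (_· x) (F.*-comm c d)) (·-assoc d c x))
      }

    line : Carrier → Linear 𝔽 X
    line x = record { fun = _· x ; +-homo = λ c d → ·-distribʳ c d x ; ·-homo = λ c d → ·-assoc c d x }

  -- This is S + f(B). With f a `line` it adds the multiples of one vector, and with f an evaluation
  -- at v it adds `B v`.
  adjoin : ∀ {X Y} → Subspace Y → Subspace X → Linear X Y → Subspace Y
  adjoin {X} {Y} S B f = record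
    { _∋_     = λ y → ∃ λ b → B ∋ b × S ∋ (y - fun b)
    ; _∋?_    = λ y → X.any∃? λ b → (B ∋? b) ×-dec (S ∋? (y - fun b))
    ; ∋-0     = X.0# , ∋-0 B , subst (S ∋_) (sym (trans (cong (0# -_) 0-homo) (x-0 0#))) (∋-0 S)
    ; ∋-minus = λ { {y} {y′} (b , b∈ , y∼) (b′ , b′∈ , y′∼) → b X.- b′ , ∋-minus B b∈ b′∈ ,
                  subst (S ∋_) (trans (minus-interchange y (fun b) y′ (fun b′))
                                      (cong (y - y′ -_) (sym (minus-homo b b′)))) (∋-minus S y∼ y′∼) }
    ; ∋-·     = λ { c {y} (b , b∈ , y∼) → c X.· b , ∋-· B c b∈ ,
                  subst (S ∋_) (trans (Linear.minus-homo (scale {Y} c) y (fun b))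
                                      (cong (c · y -_) (sym (·-homo c b)))) (∋-· S c y∼) }
    }
    where
    module X = Space X
    open Space Y
    open Linear f

  module _ {X Y : Space} (S : Subspace Y) (B : Subspace X) (f : Linear X Y) where
    open Space Y
    open Linear f

    adjoin-⊇ : S ⊆ adjoin S B f
    adjoin-⊇ y y∈ = Space.0# X , ∋-0 B , subst (S ∋_) (sym (trans (cong (y -_) 0-homo) (x-0 y))) y∈

    adjoin-∋ : ∀ {b} → B ∋ b → adjoin S B f ∋ fun b
    adjoin-∋ {b} b∈ = b , b∈ , subst (S ∋_) (sym (inverseʳ (fun b))) (∋-0 S)

    adjoin-⊆ : (T : Subspace Y) → S ⊆ T → (∀ b → B ∋ b → T ∋ fun b) → adjoin S B f ⊆ T
    adjoin-⊆ T S⊆T f∈ y (b , b∈ , y∼) = ∋-cancel T (S⊆T _ y∼) (f∈ b b∈)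

  2≤q : 2 ℕ.≤ q
  2≤q = go F.0# F.1# F.0≢1
    where
    go : ∀ {q} (x y : Fin q) → ¬ x ≡ y → 2 ℕ.≤ q
    go {suc zero}    zero zero x≢y = contradiction refl x≢y
    go {suc (suc _)} _    _    _   = s≤s (s≤s z≤n)

  instance
    q-nonZero : NonZero q
    q-nonZero = ℕ.>-nonZero (ℕ.≤-trans (s≤s z≤n) 2≤q)

  module _ {X : Space} where
    open Space X

    -- The cosets `c · x + P` for distinct scalars c are disjoint: otherwise a nonzero multiple of
    -- x, and after division x itself, would lie in P.
    ⊊⇒size : (P Q : Subspace X) → P ⊆ Q → ∀ {x} → Q ∋ x → ¬ P ∋ x → q * size P ℕ.≤ size Q
    ⊊⇒size P Q P⊆Q {x} x∈Q x∉P =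
      subst (ℕ._≤ size Q) (trans (length-cartesianProductWith _,_ (allFin q) ps) (cong (_* size P) (List.length-tabulate {n = q} id)))
        (injection⇒length≤ g (Unique.cartesianProduct⁺ (Unique.allFin⁺ q) (Unique.filter⁺ (P ∋?_) unique))
          (λ {y} y∈ → ∈-filter⁺ (Q ∋?_) (complete _) (∋-+ Q (∋-· Q _ x∈Q) (P⊆Q _ (split {y} y∈))))
          (λ {y} {z} y∈ z∈ → g-inj (split {y} y∈) (split {z} z∈)))
      where
      ps = filter (P ∋?_) elements
      g : Fin q × Carrier → Carrier
      g (c , p) = c · x + p
      split : ∀ {y} → y ∈ cartesianProduct (allFin q) ps → P ∋ proj₂ y
      split y∈ = proj₂ (∈-filter⁻ (P ∋?_) {xs = elements} (proj₂ (∈-cartesianProduct⁻ (allFin q) ps y∈)))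
      g-inj : ∀ {y z} → P ∋ proj₂ y → P ∋ proj₂ z → g y ≡ g z → y ≡ z
      g-inj {c , p} {d , r} p∈ r∈ eq = cong₂ _,_ c≡d (+-cancelˡ (c · x) p r (trans eq (cong (λ c → c · x + r) (sym c≡d))))
        where
        e = c F.- d
        ex∈P : P ∋ (e · x)
        ex∈P = subst (P ∋_) (trans (sym (+≡+⇒-≡- eq)) (sym (Linear.minus-homo (line {X} x) c d))) (∋-minus P r∈ p∈)
        c≡d : c ≡ d
        c≡d = Space.x∙y⁻¹≈ε⇒x≈y 𝔽 c d (decidable-stable (e Fin.≟ F.0#) λ e≢0 →
          let e⁻¹ , e*e⁻¹≡1 = F.inverse e e≢0 in
          x∉P (subst (P ∋_) (trans (sym (·-assoc e⁻¹ e x))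
                (trans (cong (_· x) (trans (F.*-comm e⁻¹ e) e*e⁻¹≡1)) (·-identity x))) (∋-· P e⁻¹ ex∈P)))

    ⊊⇒size< : (P Q : Subspace X) → P ⊆ Q → ∀ {x} → Q ∋ x → ¬ P ∋ x → size P ℕ.< size Q
    ⊊⇒size< P Q P⊆Q x∈Q x∉P = ℕ.<-≤-trans
      (subst (ℕ._< q * size P) (ℕ.*-identityˡ (size P))
        (ℕ.*-monoˡ-< (size P) {{ℕ.>-nonZero (size-positive P)}} 2≤q))
      (⊊⇒size P Q P⊆Q x∈Q x∉P)

    size≤⇒⊇ : (P Q : Subspace X) → P ⊆ Q → size Q ℕ.≤ size P → Q ⊆ P
    size≤⇒⊇ P Q P⊆Q Q≤P x x∈Q = decidable-stable (P ∋? x) λ x∉P →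
      ℕ.<⇒≱ (⊊⇒size< P Q P⊆Q x∈Q x∉P) Q≤P

    -- Choosing a coefficient of x embeds the quotient of P + Fx by P into the field.
    size-adjoin-line : (P : Subspace X) (x : Carrier) → size (adjoin P full (line {X} x)) ℕ.≤ size P * q
    size-adjoin-line P x = begin
      size P+x                        ≤⟨ ℕ.m≤m*n (size P+x) _ {{ℕ.>-nonZero (size-positive (0-subspace {𝔽}))}} ⟩
      size P+x * size (0-subspace {𝔽})
        ≤⟨ quotient-size P+x P full (0-subspace {𝔽}) (adjoin-⊇ P full (line {X} x)) (λ _ _ → tt) τ (λ _ _ → tt) τ-inj ⟩
      size P * size (full {𝔽})        ≡⟨ cong (size P *_) (trans (size-full {𝔽}) (List.length-tabulate {n = q} id)) ⟩
      size P * q                      ∎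
      where
      open ℕ.≤-Reasoning
      P+x = adjoin P full (line {X} x)
      τ : Carrier → Fin q
      τ y = Space.choose 𝔽 λ c → P ∋? (y - c · x)
      τ-∼ : ∀ y → P+x ∋ y → P ∋ (y - τ y · x)
      τ-∼ y (c , _ , y∼) = Space.choose-satisfies 𝔽 (λ c → P ∋? (y - c · x)) (c , y∼)
      τ-inj : ∀ y z → P+x ∋ y → P+x ∋ z → τ y F.- τ z ≡ F.0# → P ∋ (y - z)
      τ-inj y z y∈ z∈ eq = ∋-trans P (τ-∼ y y∈) (subst (λ c → P ∋ (c · x - z))
        (sym (Space.x∙y⁻¹≈ε⇒x≈y 𝔽 _ _ eq)) (∋-swap P (τ-∼ z z∈)))

    -- The index of a subspace is a power of q.
    size-jump : ∀ c (P Q : Subspace X) → P ⊆ Q → size P * q ^ c ℕ.< size Q → size P * q ^ suc c ℕ.≤ size Q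
    size-jump c P Q P⊆Q P<Q with ⊈⇒∃ Q P (λ Q⊆P → ℕ.<⇒≱ P<Q
      (ℕ.≤-trans (size-mono Q P Q⊆P) (ℕ.m≤m*n (size P) (q ^ c) {{ℕ.m^n≢0 q c}})))
    size-jump zero    P Q P⊆Q _   | x , x∈Q , x∉P =
      subst (ℕ._≤ size Q) (trans (ℕ.*-comm q (size P)) (cong (size P *_) (sym (ℕ.*-identityʳ q)))) (⊊⇒size P Q P⊆Q x∈Q x∉P)
    -- Induction through P + Fx. Its size is at most q |P|, which preserves the strict inequality
    -- for the smaller exponent, and at least q |P|, which restores the factor in the conclusion.
    size-jump (suc c) P Q P⊆Q P<Q | x , x∈Q , x∉P = begin
      size P * (q * q ^ suc c)  ≡⟨ trans (sym (ℕ.*-assoc (size P) q _)) (cong (_* q ^ suc c) (ℕ.*-comm (size P) q)) ⟩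
      q * size P * q ^ suc c    ≤⟨ ℕ.*-monoˡ-≤ (q ^ suc c) (⊊⇒size P P+x P⊆P+x x∈P+x x∉P) ⟩
      size P+x * q ^ suc c
        ≤⟨ size-jump c P+x Q (adjoin-⊆ P full (line {X} x) Q P⊆Q (λ c _ → ∋-· Q c x∈Q)) P+x<Q ⟩
      size Q                    ∎
      where
      open ℕ.≤-Reasoning
      P+x = adjoin P full (line {X} x)
      P⊆P+x = adjoin-⊇ P full (line {X} x)
      x∈P+x : P+x ∋ x
      x∈P+x = subst (P+x ∋_) (·-identity x) (adjoin-∋ P full (line {X} x) {F.1#} tt)
      P+x<Q : size P+x * q ^ c ℕ.< size Q
      P+x<Q = ℕ.≤-<-trans (ℕ.≤-trans (ℕ.*-monoˡ-≤ (q ^ c) (size-adjoin-line P x))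
                                     (ℕ.≤-reflexive (ℕ.*-assoc (size P) q (q ^ c)))) P<Q

  -- Schur's bound for commutative algebras

  record Action (M V : Space) : Set where
    private
      module M = Space M
      module V = Space V
    infixr 7 _▹_
    field
      _▹_  : M.Carrier → V.Carrier → V.Carrier
      ▹-+ˡ : ∀ a b v → (a M.+ b) ▹ v ≡ a ▹ v V.+ b ▹ v
      ▹-·ˡ : ∀ c a v → (c M.· a) ▹ v ≡ c V.· a ▹ v
      ▹-+ʳ : ∀ a v w → a ▹ (v V.+ w) ≡ a ▹ v V.+ a ▹ w
      ▹-·ʳ : ∀ a c v → a ▹ (c V.· v) ≡ c V.· a ▹ v

    eval : V.Carrier → Linear M V
    eval v = record { fun = _▹ v ; +-homo = λ a b → ▹-+ˡ a b v ; ·-homo = λ c a → ▹-·ˡ c a v }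

    act : M.Carrier → Linear V V
    act a = record { fun = a ▹_ ; +-homo = ▹-+ʳ a ; ·-homo = ▹-·ʳ a }

  -- Products and the unit are described by their effect on V, so M itself needs only the bilinear
  -- action and no multiplication.
  record IsCommutativeAlgebra {M V : Space} (action : Action M V) (A : Subspace M) : Set where
    open Action action
    field
      commute : ∀ {a b} → A ∋ a → A ∋ b → ∀ v → a ▹ b ▹ v ≡ b ▹ a ▹ v
      product : ∀ {a b} → A ∋ a → A ∋ b → ∃ λ c → A ∋ c × ∀ v → c ▹ v ≡ a ▹ b ▹ v
      unit    : ∃ λ e → A ∋ e × ∀ v → e ▹ v ≡ v

  module Schur {M V : Space} (action : Action M V) (A : Subspace M)
               (isCommutativeAlgebra : IsCommutativeAlgebra action A) where

    open Action action
    open IsCommutativeAlgebra isCommutativeAlgebra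
    open Space V

    Invariant : Subspace V → Set
    Invariant S = ∀ {a v} → A ∋ a → S ∋ v → S ∋ (a ▹ v)

    -- B is a parameter because homomorphisms into a simple quotient are later counted inside the
    -- ideal `K₁` rather than in all of A.
    colon : Subspace M → Subspace V → Subspace V → Subspace M
    colon B S X = record
      { _∋_     = λ b → B ∋ b × (∀ x → X ∋ x → S ∋ (b ▹ x))
      ; _∋?_    = λ b → (B ∋? b) ×-dec all∀? λ x → (X ∋? x) →-dec (S ∋? (b ▹ x))
      ; ∋-0     = ∋-0 B , λ x _ → subst (S ∋_) (sym (Linear.0-homo (eval x))) (∋-0 S)
      ; ∋-minus = λ { (a∈ , aX) (b∈ , bX) → ∋-minus B a∈ b∈ ,
                  λ x x∈ → subst (S ∋_) (sym (Linear.minus-homo (eval x) _ _)) (∋-minus S (aX x x∈) (bX x x∈)) }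
      ; ∋-·     = λ { c (a∈ , aX) → ∋-· B c a∈ ,
                  λ x x∈ → subst (S ∋_) (sym (▹-·ˡ c _ x)) (∋-· S c (aX x x∈)) }
      }

    infixl 6 _⊕_
    _⊕_ : Subspace V → Carrier → Subspace V
    S ⊕ v = adjoin S A (eval v)

    ∋-⊕ : ∀ S v → S ⊕ v ∋ v
    ∋-⊕ S v = let e , e∈ , e▹ = unit in subst (S ⊕ v ∋_) (e▹ v) (adjoin-∋ S A (eval v) e∈)

    -- Stated for any B with AB ⊆ B as operators, to cover both S + Av and S + K₂v.
    adjoin-invariant : ∀ S B v → Invariant S →
      (∀ {a b} → A ∋ a → B ∋ b → ∃ λ c → B ∋ c × ∀ v → c ▹ v ≡ a ▹ b ▹ v) →
      Invariant (adjoin S B (eval v))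
    adjoin-invariant S B v inv mul {a} {y} a∈ (b , b∈ , y∼) with c , c∈ , c▹ ← mul a∈ b∈ =
      c , c∈ , subst (S ∋_) (trans (Linear.minus-homo (act a) y (b ▹ v)) (cong (a ▹ y -_) (sym (c▹ v)))) (inv a∈ y∼)

    ⊕-invariant : ∀ S v → Invariant S → Invariant (S ⊕ v)
    ⊕-invariant S v inv = adjoin-invariant S A v inv product

    ⊕-⊆ : ∀ S v T → S ⊆ T → Invariant T → T ∋ v → S ⊕ v ⊆ T
    ⊕-⊆ S v T S⊆T inv v∈ = adjoin-⊆ S A (eval v) T S⊆T λ _ b∈ → inv b∈ v∈

    -- By commutativity `c ▹ b ▹ v` equals `b ▹ c ▹ v`, so the value of c at v alone controls c on
    -- all of Av modulo the invariant S.
    colon-⊕ : ∀ S X {v c} → Invariant S → A ∋ c → (∀ x → X ∋ x → S ∋ (c ▹ x)) → S ∋ (c ▹ v) →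
              ∀ t → X ⊕ v ∋ t → S ∋ (c ▹ t)
    colon-⊕ S X {v} {c} inv c∈ cX cv t (b , b∈ , t∼) =
      ∋-cancel S (subst (S ∋_) (Linear.minus-homo (act c) t (b ▹ v)) (cX _ t∼))
                 (subst (S ∋_) (sym (commute c∈ b∈ v)) (inv b∈ cv))

    -- Evaluation at v embeds colon B S X / colon B S T into Q / S.
    size-colon-⊕ : ∀ B S X T Q v → B ⊆ A → Invariant S → X ⊆ T → T ⊆ X ⊕ v → S ⊆ Q →
                   (∀ b → colon B S X ∋ b → Q ∋ (b ▹ v)) →
                   size (colon B S X) * size S ℕ.≤ size (colon B S T) * size Q
    size-colon-⊕ B S X T Q v B⊆A inv X⊆T T⊆ S⊆Q ▹v∈ =
      quotient-size (colon B S X) (colon B S T) Q S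
        (λ { b (b∈ , bT) → b∈ , λ x x∈ → bT x (X⊆T x x∈) }) S⊆Q (_▹ v) ▹v∈
        λ { a b (a∈ , aX) (b∈ , bX) ab∈ → let c∈ = ∋-minus B a∈ b∈ in c∈ ,
            λ t t∈ → colon-⊕ S X inv (B⊆A _ c∈)
              (λ x x∈ → subst (S ∋_) (sym (Linear.minus-homo (eval x) a b)) (∋-minus S (aX x x∈) (bX x x∈)))
              (subst (S ∋_) (sym (Linear.minus-homo (eval v) a b)) ab∈) t (T⊆ t t∈) }

    Simple : Subspace V → Subspace V → Set
    Simple S W = ∀ w → W ∋ w → ¬ S ∋ w → W ⊆ S ⊕ w

    -- Descent on the size of S + Aw: if some u in it outside S fails to generate it modulo S, then
    -- S + Au is strictly smaller. The number g bounds the size.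
    simple-above : ∀ S T → Invariant S → Invariant T → S ⊆ T → ¬ T ⊆ S →
                   ∃ λ w → T ∋ w × ¬ S ∋ w × Simple S (S ⊕ w)
    simple-above S T invS invT S⊆T T⊈S with v , v∈ , v∉ ← ⊈⇒∃ T S T⊈S = go _ v v∈ v∉ ℕ.≤-refl
      where
      go : ∀ g w → T ∋ w → ¬ S ∋ w → size (S ⊕ w) ℕ.≤ g → ∃ λ w → T ∋ w × ¬ S ∋ w × Simple S (S ⊕ w)
      go zero w _ _ ≤0 = contradiction (ℕ.≤-trans (size-positive (S ⊕ w)) ≤0) λ ()
      go (suc g) w w∈ w∉ ≤g
        with any∃? (λ u → (S ⊕ w ∋? u) ×-dec ¬? (S ∋? u) ×-dec ¬? (S ⊕ w ⊆? S ⊕ u))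
      ... | no ∄ = w , w∈ , w∉ , λ u u∈ u∉ → decidable-stable (S ⊕ w ⊆? S ⊕ u) λ ⊈ → ∄ (u , u∈ , u∉ , ⊈)
      ... | yes (u , u∈ , u∉ , ⊈) =
        go g u (⊕-⊆ S w T S⊆T invT w∈ u u∈) u∉ (ℕ.≤-pred (ℕ.≤-trans <w ≤g))
        where
        ⊕u⊆⊕w = ⊕-⊆ S u (S ⊕ w) (adjoin-⊇ S A (eval w)) (⊕-invariant S w invS) u∈
        <w : size (S ⊕ u) ℕ.< size (S ⊕ w)
        <w with y , y∈ , y∉ ← ⊈⇒∃ (S ⊕ w) (S ⊕ u) ⊈ = ⊊⇒size< (S ⊕ u) (S ⊕ w) ⊕u⊆⊕w y∈ y∉

    -- Ascent from W: a vector v of T outside U is adjoined repeatedly until U + Av reaches T. Then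
    -- the last U is the substitute for a hyperplane. The number g bounds how much U can still grow.
    cocyclic-below : ∀ W T → Invariant W → Invariant T → W ⊆ T → ¬ T ⊆ W →
                     Σ (Subspace V) λ U → ∃ λ v → Invariant U × W ⊆ U × U ⊆ T × T ∋ v × ¬ U ∋ v × T ⊆ U ⊕ v
    cocyclic-below W T invW invT W⊆T T⊈W = go (size T) W invW (λ _ w∈ → w∈) W⊆T T⊈W (ℕ.m≤n+m (size T) (size W))
      where
      go : ∀ g U → Invariant U → W ⊆ U → U ⊆ T → ¬ T ⊆ U → size T ℕ.≤ size U ℕ.+ g →
           Σ (Subspace V) λ U → ∃ λ v → Invariant U × W ⊆ U × U ⊆ T × T ∋ v × ¬ U ∋ v × T ⊆ U ⊕ v
      go zero U _ _ U⊆T T⊈U ≤g =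
        contradiction (size≤⇒⊇ U T U⊆T (subst (size T ℕ.≤_) (ℕ.+-identityʳ (size U)) ≤g)) T⊈U
      go (suc g) U inv W⊆U U⊆T T⊈U ≤g with v , v∈ , v∉ ← ⊈⇒∃ T U T⊈U | T ⊆? U ⊕ v
      ... | yes T⊆ = U , v , inv , W⊆U , U⊆T , v∈ , v∉ , T⊆
      ... | no T⊈ = go g (U ⊕ v) (⊕-invariant U v inv) (λ w w∈ → U⊆⊕ w (W⊆U w w∈))
                       (⊕-⊆ U v T U⊆T invT v∈) T⊈
                       (ℕ.≤-trans ≤g (ℕ.≤-trans (ℕ.≤-reflexive (ℕ.+-suc (size U) g)) (ℕ.+-monoˡ-≤ g (⊊⇒size< U (U ⊕ v) U⊆⊕ (∋-⊕ U v) v∉))))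
        where U⊆⊕ = adjoin-⊇ U A (eval v)

    -- Hom(T / X, W / S) is no larger than T / X when W / S is simple.
    module _ (S W : Subspace V) (invS : Invariant S) (S⊆W : S ⊆ W) (simple : Simple S W)
             (T : Subspace V) (invT : Invariant T) (B : Subspace M) (B⊆A : B ⊆ A)
             (BT⊆W : ∀ b → B ∋ b → ∀ t → T ∋ t → W ∋ (b ▹ t)) where

      -- As W / S is simple, bx generates it, so each w in W is `a ▹ b ▹ x = b ▹ a ▹ x` modulo S for
      -- some a in A. Hence b maps X′ onto W / S and kills X; τ picks preimages under b.
      size-simple≤ : ∀ X X′ b → X ⊆ X′ → X′ ⊆ T → Invariant X′ → colon B S X ∋ b → ∀ x → X′ ∋ x → ¬ S ∋ (b ▹ x) →
                     size W * size X ℕ.≤ size S * size X′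
      size-simple≤ X X′ b X⊆X′ X′⊆T invX′ (b∈ , bX) x x∈ bx∉ =
        quotient-size W S X′ X S⊆W X⊆X′ τ (λ w w∈ → proj₁ (τ-∼ w w∈))
          λ w w′ w∈ w′∈ τw∼ → ∋-trans S (proj₂ (τ-∼ w w∈))
            (∋-trans S (subst (S ∋_) (Linear.minus-homo (act b) (τ w) (τ w′)) (bX _ τw∼)) (∋-swap S (proj₂ (τ-∼ w′ w′∈))))
        where
        P? : ∀ w → Decidable λ y → X′ ∋ y × S ∋ (w - b ▹ y)
        P? w y = (X′ ∋? y) ×-dec (S ∋? (w - b ▹ y))
        τ : Carrier → Carrier
        τ w = choose (P? w)
        τ-∼ : ∀ w → W ∋ w → X′ ∋ τ w × S ∋ (w - b ▹ τ w)
        τ-∼ w w∈ with a , a∈ , w∼ ← simple (b ▹ x) (BT⊆W b b∈ x (X′⊆T x x∈)) bx∉ w w∈ =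
          choose-satisfies (P? w) (a ▹ x , invX′ a∈ x∈ ,
            subst (λ z → S ∋ (w - z)) (commute a∈ (B⊆A b b∈) x) w∼)

      -- X is enlarged to T by one vector x at a time. If the colon N shrinks at such a step, the
      -- loss N / N′ embeds into W / S by evaluation at x, and an element b that was lost shows
      -- through `size-simple≤` that W / S is no larger than X′ / X.
      size-colon-simple : ∀ X → Invariant X → X ⊆ T → size (colon B S X) * size X ℕ.≤ size (colon B S T) * size T
      size-colon-simple X invX X⊆T = go (size T) X invX X⊆T (ℕ.m≤n+m (size T) (size X))
        where
        open ℕ.≤-Reasoning
        go : ∀ g X → Invariant X → X ⊆ T → size T ℕ.≤ size X ℕ.+ g →
             size (colon B S X) * size X ℕ.≤ size (colon B S T) * size T
        go g X invX X⊆T ≤g with T ⊆? X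
        ... | yes T⊆X = ℕ.*-mono-≤ (size-mono (colon B S X) (colon B S T) λ { b (b∈ , bX) → b∈ , λ t t∈ → bX t (T⊆X t t∈) })
                                   (size-mono X T X⊆T)
        go zero X invX X⊆T ≤g | no T⊈X =
          contradiction (size≤⇒⊇ X T X⊆T (subst (size T ℕ.≤_) (ℕ.+-identityʳ (size X)) ≤g)) T⊈X
        go (suc g) X invX X⊆T ≤g | no T⊈X with x , x∈ , x∉ ← ⊈⇒∃ T X T⊈X =
          ℕ.≤-trans step (go g X′ (⊕-invariant X x invX) X′⊆T
            (ℕ.≤-trans ≤g (ℕ.≤-trans (ℕ.≤-reflexive (ℕ.+-suc (size X) g)) (ℕ.+-monoˡ-≤ g (⊊⇒size< X X′ X⊆X′ (∋-⊕ X x) x∉)))))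
          where
          X′ = X ⊕ x
          X⊆X′ = adjoin-⊇ X A (eval x)
          X′⊆T = ⊕-⊆ X x T X⊆T invT x∈
          N = colon B S X
          N′ = colon B S X′
          step : size N * size X ℕ.≤ size N′ * size X′
          step with N ⊆? N′
          ... | yes N⊆N′ = ℕ.*-mono-≤ (size-mono N N′ N⊆N′) (size-mono X X′ X⊆X′)
          ... | no N⊈N′ with b , (b∈ , bX) , b∉ ← ⊈⇒∃ N N′ N⊈N′ =
            ℕ.*-cancelʳ-≤ _ _ (size S * size W) {{ℕ.m*n≢0 _ _ {{ℕ.>-nonZero (size-positive S)}} {{ℕ.>-nonZero (size-positive W)}}}} (begin
              size N * size X * (size S * size W)
                ≡⟨ solve 4 (λ n x s w → n :* x :* (s :* w) := n :* s :* (w :* x)) refl (size N) (size X) (size S) (size W) ⟩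
              size N * size S * (size W * size X)    ≤⟨ ℕ.*-mono-≤
                (size-colon-⊕ B S X X′ W x B⊆A invS X⊆X′ (λ _ t∈ → t∈) S⊆W λ b (b∈ , _) → BT⊆W b b∈ x x∈)
                (size-simple≤ X X′ b X⊆X′ X′⊆T (⊕-invariant X x invX) (b∈ , bX) x (∋-⊕ X x)
                  λ bx∈ → b∉ (b∈ , colon-⊕ S X invS (B⊆A b b∈) bX bx∈)) ⟩
              size N′ * size W * (size S * size X′)
                ≡⟨ solve 4 (λ n x s w → n :* w :* (s :* x) := n :* x :* (s :* w)) refl (size N′) (size X′) (size S) (size W) ⟩
              size N′ * size X′ * (size S * size W)  ∎)
            where open +-*-Solver

    -- For W / S simple and U + Av = T with W ⊆ U, the sets K₁ = {a : aT ⊆ W} and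
    -- K₂ = {a : aU ⊆ S} satisfy K₁ K₂ T ⊆ S, so that K₁ kills X = S + K₂ v modulo S.
    module _ (S W U T : Subspace V) (v : Carrier)
             (invS : Invariant S) (invU : Invariant U) (invT : Invariant T)
             (S⊆W : S ⊆ W) (W⊆U : W ⊆ U) (U⊆T : U ⊆ T) (v∈T : T ∋ v)
             (T⊆U⊕v : T ⊆ U ⊕ v) (simple : Simple S W) where
      private
        K₁ = colon A W T
        K₂ = colon A S U
        N  = colon A S T
        X  = adjoin S K₂ (eval v)

        S⊆T : S ⊆ T
        S⊆T x x∈ = U⊆T x (W⊆U x (S⊆W x x∈))

        X⊆T : X ⊆ T
        X⊆T = adjoin-⊆ S K₂ (eval v) T S⊆T λ _ (b∈ , _) → invT b∈ v∈T

        K₂-ideal : ∀ {a b} → A ∋ a → K₂ ∋ b → ∃ λ c → K₂ ∋ c × ∀ v → c ▹ v ≡ a ▹ b ▹ v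
        K₂-ideal a∈ (b∈ , bU) with c , c∈ , c▹ ← product a∈ b∈ =
          c , (c∈ , λ u u∈ → subst (S ∋_) (sym (c▹ u)) (invS a∈ (bU u u∈))) , c▹

        -- Commuting turns `a ▹ b ▹ v` into `b ▹ a ▹ v`, where av lies in W ⊆ U and b sends U into
        -- S.
        K₁X⊆S : ∀ a → K₁ ∋ a → ∀ x → X ∋ x → S ∋ (a ▹ x)
        K₁X⊆S a (a∈ , aT) x (b , (b∈ , bU) , x∼) =
          ∋-cancel S (subst (S ∋_) (Linear.minus-homo (act a) x (b ▹ v)) (invS a∈ x∼))
                     (subst (S ∋_) (sym (commute a∈ b∈ v)) (bU _ (W⊆U _ (aT v v∈T))))

      -- The factors satisfy |K₁ / N| ≤ |T / X| and |K₂ / N| ≤ |X / S|. The unknown size of X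
      -- cancels in the product, leaving |T / S|.
      size-K₁*size-K₂ : size K₁ * size K₂ * size S ℕ.≤ size N * size N * size T
      size-K₁*size-K₂ = ℕ.*-cancelʳ-≤ _ _ (size X) {{ℕ.>-nonZero (size-positive X)}} (begin
        size K₁ * size K₂ * size S * size X
          ≡⟨ solve 4 (λ k l s x → k :* l :* s :* x := k :* x :* (l :* s)) refl (size K₁) (size K₂) (size S) (size X) ⟩
        size K₁ * size X * (size K₂ * size S)  ≤⟨ ℕ.*-mono-≤ K₁≤ K₂≤ ⟩
        size N * size T * (size N * size X)
          ≡⟨ solve 3 (λ n t x → n :* t :* (n :* x) := n :* n :* t :* x) refl (size N) (size T) (size X) ⟩
        size N * size N * size T * size X      ∎)
        where
        open ℕ.≤-Reasoning
        open +-*-Solver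
        K₁≤ : size K₁ * size X ℕ.≤ size N * size T
        K₁≤ = ℕ.≤-trans
          -- Since K₁X ⊆ S, every element of `K₁` induces a homomorphism from T / X to W / S.
          (ℕ.*-monoˡ-≤ (size X) (size-mono K₁ (colon K₁ S X) λ a a∈ → a∈ , K₁X⊆S a a∈))
          (ℕ.≤-trans
            (size-colon-simple S W invS S⊆W simple T invT K₁ (λ _ → proj₁) (λ _ → proj₂) X
              (adjoin-invariant S K₂ v invS K₂-ideal) X⊆T)
            (ℕ.*-monoˡ-≤ (size T) (size-mono (colon K₁ S T) N λ { _ ((a∈ , _) , aT) → a∈ , aT })))
        K₂≤ : size K₂ * size S ℕ.≤ size N * size X
        K₂≤ = size-colon-⊕ A S U T X v (λ _ a∈ → a∈) invS U⊆T T⊆U⊕v (adjoin-⊇ S K₂ (eval v))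
          λ _ → adjoin-∋ S K₂ (eval v)

    schur : ∀ d S T → Invariant S → Invariant T → S ⊆ T → size T ℕ.≤ size S * q ^ d →
            size A ℕ.≤ size (colon A S T) * q ^ m d
    schur d S T invS invT S⊆T T≤ with T ⊆? S
    ... | yes T⊆S = ℕ.≤-trans (size-mono A (colon A S T) λ a a∈ → a∈ , λ t t∈ → invS a∈ (T⊆S t t∈))
                              (ℕ.m≤m*n _ (q ^ m d) {{ℕ.m^n≢0 q (m d)}})
    schur zero S T invS invT S⊆T T≤ | no T⊈S =
      contradiction (size≤⇒⊇ S T S⊆T (subst (size T ℕ.≤_) (ℕ.*-identityʳ (size S)) T≤)) T⊈S
    schur (suc d) S T invS invT S⊆T T≤ | no T⊈S
      with w , w∈ , w∉ , simple ← simple-above S T invS invT S⊆T T⊈S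
      with T ⊆? S ⊕ w
    -- Here T / S is simple, generated by w, and evaluation at w embeds A / N into it.
    ... | yes T⊆W = ℕ.*-cancelʳ-≤ _ _ (size S) {{ℕ.>-nonZero (size-positive S)}} (begin
      size A * size S
        ≤⟨ ℕ.*-monoˡ-≤ (size S) (size-mono A (colon A S S) λ a a∈ → a∈ , λ s s∈ → invS a∈ s∈) ⟩
      size (colon A S S) * size S
        ≤⟨ size-colon-⊕ A S S T T w (λ _ a∈ → a∈) invS S⊆T T⊆W S⊆T (λ b (b∈ , _) → invT b∈ w∈) ⟩
      size N * size T                    ≤⟨ ℕ.*-monoʳ-≤ (size N) T≤ ⟩
      size N * (size S * q ^ suc d)
        ≤⟨ ℕ.*-monoʳ-≤ (size N) (ℕ.*-monoʳ-≤ (size S) (ℕ.^-monoʳ-≤ q (n≤m[n] (suc d)))) ⟩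
      size N * (size S * q ^ m (suc d))
        ≡⟨ solve 3 (λ n s r → n :* (s :* r) := n :* r :* s) refl (size N) (size S) (q ^ m (suc d)) ⟩
      size N * q ^ m (suc d) * size S    ∎)
      where
      open ℕ.≤-Reasoning
      open +-*-Solver
      N = colon A S T
    ... | no T⊈W
      with U , v , invU , W⊆U , U⊆T , v∈ , v∉ , T⊆ ← cocyclic-below (S ⊕ w) T (⊕-invariant S w invS) invT (⊕-⊆ S w T S⊆T invT w∈) T⊈W =
      -- If the bound failed, `size-jump` would raise the index of N in A to at least q to the power
      -- m (d + 1) + 1. The square of this contradicts the product of the two inductive bounds by
      -- `m-step`.
      ℕ.≮⇒≥ λ N<A → ℕ.<⇒≱ (ℕ.*-monoʳ-< n² {{n²≢0}} (ℕ.^-monoʳ-< q 2≤q (m-step d))) (begin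
        n² * q ^ (suc (m (suc d)) ℕ.+ suc (m (suc d)))
          ≡⟨ cong (n² *_) (ℕ.^-distribˡ-+-* q (suc (m (suc d))) _) ⟩
        n² * (Q * Q)
          ≡⟨ solve 2 (λ n q → n :* n :* (q :* q) := n :* q :* (n :* q)) refl (size N) Q ⟩
        size N * Q * (size N * Q)
          ≤⟨ ℕ.*-mono-≤ (size-jump (m (suc d)) N A (λ _ → proj₁) N<A) (size-jump (m (suc d)) N A (λ _ → proj₁) N<A) ⟩
        size A * size A
          ≤⟨ ℕ.*-mono-≤ (schur d W T invW invT W⊆T T≤W) (schur d S U invS invU S⊆U U≤S) ⟩
        size K₁ * q ^ m d * (size K₂ * q ^ m d)
          ≡⟨ solve 3 (λ k l q → k :* q :* (l :* q) := k :* l :* (q :* q)) refl (size K₁) (size K₂) (q ^ m d) ⟩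
        size K₁ * size K₂ * (q ^ m d * q ^ m d)               ≤⟨ ℕ.*-monoˡ-≤ _ K₁K₂≤ ⟩
        n² * q ^ suc d * (q ^ m d * q ^ m d)
          ≡⟨ solve 3 (λ n r q → n :* r :* (q :* q) := n :* (q :* q :* r)) refl n² (q ^ suc d) (q ^ m d) ⟩
        n² * (q ^ m d * q ^ m d * q ^ suc d)
          ≡⟨ cong (λ x → n² * (x * q ^ suc d)) (sym (ℕ.^-distribˡ-+-* q (m d) (m d))) ⟩
        n² * (q ^ (m d ℕ.+ m d) * q ^ suc d)
          ≡⟨ cong (n² *_) (sym (ℕ.^-distribˡ-+-* q (m d ℕ.+ m d) (suc d))) ⟩
        n² * q ^ (m d ℕ.+ m d ℕ.+ suc d)                      ∎)
      where
      open ℕ.≤-Reasoning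
      open +-*-Solver
      W = S ⊕ w
      N = colon A S T
      K₁ = colon A W T
      K₂ = colon A S U
      Q = q ^ suc (m (suc d))
      n² = size N * size N
      n²≢0 : NonZero n²
      n²≢0 = ℕ.m*n≢0 _ _ {{ℕ.>-nonZero (size-positive N)}} {{ℕ.>-nonZero (size-positive N)}}
      invW = ⊕-invariant S w invS
      S⊆W = adjoin-⊇ S A (eval w)
      W⊆T = ⊕-⊆ S w T S⊆T invT w∈
      S⊆U : S ⊆ U
      S⊆U x x∈ = W⊆U x (S⊆W x x∈)
      -- W lies strictly above S and U strictly below T, so T / W and U / S each have at least one
      -- dimension less than T / S.
      T≤W : size T ℕ.≤ size W * q ^ d
      T≤W = begin
        size T                ≤⟨ T≤ ⟩
        size S * q ^ suc d    ≡⟨ solve 3 (λ s q r → s :* (q :* r) := q :* s :* r) refl (size S) q (q ^ d) ⟩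
        q * size S * q ^ d    ≤⟨ ℕ.*-monoˡ-≤ (q ^ d) (⊊⇒size S W S⊆W (∋-⊕ S w) w∉) ⟩
        size W * q ^ d        ∎
      U≤S : size U ℕ.≤ size S * q ^ d
      U≤S = ℕ.*-cancelˡ-≤ q (begin
        q * size U            ≤⟨ ⊊⇒size U T U⊆T v∈ v∉ ⟩
        size T                ≤⟨ T≤ ⟩
        size S * q ^ suc d    ≡⟨ solve 3 (λ s q r → s :* (q :* r) := q :* (s :* r)) refl (size S) q (q ^ d) ⟩
        q * (size S * q ^ d)  ∎)
      K₁K₂≤ : size K₁ * size K₂ ℕ.≤ n² * q ^ suc d
      K₁K₂≤ = ℕ.*-cancelʳ-≤ _ _ (size S) {{ℕ.>-nonZero (size-positive S)}} (begin
        size K₁ * size K₂ * size S    ≤⟨ size-K₁*size-K₂ S W U T v invS invU invT S⊆W W⊆U U⊆T v∈ T⊆ simple ⟩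
        n² * size T                   ≤⟨ ℕ.*-monoʳ-≤ n² T≤ ⟩
        n² * (size S * q ^ suc d)
          ≡⟨ solve 3 (λ n s r → n :* (s :* r) := n :* r :* s) refl n² (size S) (q ^ suc d) ⟩
        n² * q ^ suc d * size S       ∎)

  -- Commuting matrices

  power : Space → ℕ → Space
  power X n = record
    { Carrier        = Vec X.Carrier n
    ; _+_            = Vec.zipWith X._+_
    ; 0#             = Vec.replicate n X.0#
    ; neg            = Vec.map X.neg
    ; isAbelianGroup = record
      { isGroup = record
        { isMonoid = record
          { isSemigroup = record
            { isMagma = isMagma _
            ; assoc   = Vec.zipWith-assoc X.assoc
            }
          ; identity = Vec.zipWith-identityˡ X.identityˡ , Vec.zipWith-identityʳ X.identityʳ
          }
        ; inverse = Vec.zipWith-inverseˡ X.inverseˡ , Vec.zipWith-inverseʳ X.inverseʳ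
        ; ⁻¹-cong = cong _
        }
      ; comm = Vec.zipWith-comm X.comm
      }
    ; _·_            = λ c → Vec.map (c X.·_)
    ; ·-distribˡ     = distribˡ
    ; ·-distribʳ     = distribʳ
    ; ·-assoc        = λ c d v → trans (Vec.map-cong (X.·-assoc c d) v) (Vec.map-∘ (c X.·_) (d X.·_) v)
    ; ·-identity     = λ v → trans (Vec.map-cong X.·-identity v) (Vec.map-id v)
    ; _≟_            = Vec.≡-dec X._≟_
    ; elements       = vectors n X.elements
    ; complete       = ∈-vectors X.complete
    ; unique         = vectors-unique n X.unique
    }
    where
    module X = Space X
    distribˡ : ∀ {n} c (v w : Vec X.Carrier n) →
               Vec.map (c X.·_) (Vec.zipWith X._+_ v w) ≡ Vec.zipWith X._+_ (Vec.map (c X.·_) v) (Vec.map (c X.·_) w)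
    distribˡ c []      []      = refl
    distribˡ c (x ∷ v) (y ∷ w) = cong₂ _∷_ (X.·-distribˡ c x y) (distribˡ c v w)
    distribʳ : ∀ {n} c d (v : Vec X.Carrier n) →
               Vec.map ((c F.+ d) X.·_) v ≡ Vec.zipWith X._+_ (Vec.map (c X.·_) v) (Vec.map (d X.·_) v)
    distribʳ c d []      = refl
    distribʳ c d (x ∷ v) = cong₂ _∷_ (X.·-distribʳ c d x) (distribʳ c d v)

  module Combination (X : Space) where
    open Space X

    -- With X = `𝔽` this is the dot product, and with X = `𝕍` a row vector times a matrix.
    combine : ∀ {k} → Vec (Fin q) k → Vec Carrier k → Carrier
    combine []       []       = 0#
    combine (c ∷ cs) (x ∷ xs) = c · x + combine cs xs

    combine-+ˡ : ∀ {k} cs ds (xs : Vec Carrier k) →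
                 combine (Vec.zipWith F._+_ cs ds) xs ≡ combine cs xs + combine ds xs
    combine-+ˡ []       []       []       = sym (identityˡ 0#)
    combine-+ˡ (c ∷ cs) (d ∷ ds) (x ∷ xs) =
      trans (cong₂ _+_ (·-distribʳ c d x) (combine-+ˡ cs ds xs)) (interchange _ _ _ _)

    combine-+ʳ : ∀ {k} cs (xs ys : Vec Carrier k) →
                 combine cs (Vec.zipWith _+_ xs ys) ≡ combine cs xs + combine cs ys
    combine-+ʳ []       []       []       = sym (identityˡ 0#)
    combine-+ʳ (c ∷ cs) (x ∷ xs) (y ∷ ys) =
      trans (cong₂ _+_ (·-distribˡ c x y) (combine-+ʳ cs xs ys)) (interchange _ _ _ _)

    combine-·ˡ : ∀ {k} d cs (xs : Vec Carrier k) → combine (Vec.map (d F.*_) cs) xs ≡ d · combine cs xs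
    combine-·ˡ d []       []       = sym (Linear.0-homo (scale {X} d))
    combine-·ˡ d (c ∷ cs) (x ∷ xs) =
      trans (cong₂ _+_ (·-assoc d c x) (combine-·ˡ d cs xs)) (sym (·-distribˡ d _ _))

    combine-0ˡ : ∀ {k} (xs : Vec Carrier k) → combine (Vec.replicate k F.0#) xs ≡ 0#
    combine-0ˡ []       = refl
    combine-0ˡ (x ∷ xs) = trans (cong₂ _+_ (Linear.0-homo (line {X} x)) (combine-0ˡ xs)) (identityˡ 0#)

  open Combination using (combine)

  combine-homo : ∀ {X Y} (f : Linear X Y) {k} cs (xs : Vec ∣ X ∣ k) →
                 Linear.fun f (combine X cs xs) ≡ combine Y cs (Vec.map (Linear.fun f) xs)
  combine-homo f []       []       = Linear.0-homo f
  combine-homo {X} {Y} f (c ∷ cs) (x ∷ xs) =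
    trans (Linear.+-homo f _ _) (cong₂ (Space._+_ Y) (Linear.·-homo f c x) (combine-homo f cs xs))

  map-linear : ∀ {X Y} → Linear X Y → ∀ n → Linear (power X n) (power Y n)
  map-linear {X} {Y} f n = record
    { fun    = Vec.map fun
    ; +-homo = map-+
    ; ·-homo = λ c v → trans (sym (Vec.map-∘ fun _ v)) (trans (Vec.map-cong (·-homo c) v) (Vec.map-∘ _ fun v))
    }
    where
    open Linear f
    map-+ : ∀ {n} (v w : Vec ∣ X ∣ n) →
            Vec.map fun (Vec.zipWith (Space._+_ X) v w) ≡ Vec.zipWith (Space._+_ Y) (Vec.map fun v) (Vec.map fun w)
    map-+ []      []      = refl
    map-+ (x ∷ v) (y ∷ w) = cong₂ _∷_ (+-homo x y) (map-+ v w)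

  module Matrices (n : ℕ) where

    𝕍 : Space
    𝕍 = power 𝔽 n

    𝕄 : Space
    𝕄 = power 𝕍 n

    dot : ∀ {n} → Vec (Fin q) n → Vec (Fin q) n → Fin q
    dot = combine 𝔽

    dot-linearˡ : ∀ {n} → Vec (Fin q) n → Linear (power 𝔽 n) 𝔽
    dot-linearˡ v = record
      { fun    = λ r → dot r v
      ; +-homo = λ r s → Combination.combine-+ˡ 𝔽 r s v
      ; ·-homo = λ c r → Combination.combine-·ˡ 𝔽 c r v
      }

    dot-linearʳ : ∀ {n} → Vec (Fin q) n → Linear (power 𝔽 n) 𝔽
    dot-linearʳ r = record
      { fun    = dot r
      ; +-homo = Combination.combine-+ʳ 𝔽 r
      ; ·-homo = λ c v → sym (combine-homo (scale {𝔽} c) r v)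
      }

    apply : ∀ {k l} → Vec (Vec (Fin q) k) l → Vec (Fin q) k → Vec (Fin q) l
    apply a v = Vec.map (λ r → dot r v) a

    apply-+ʳ : ∀ {k l} (a : Vec (Vec (Fin q) k) l) v w →
               apply a (Vec.zipWith F._+_ v w) ≡ Vec.zipWith F._+_ (apply a v) (apply a w)
    apply-+ʳ []      v w = refl
    apply-+ʳ (r ∷ a) v w = cong₂ _∷_ (Linear.+-homo (dot-linearʳ r) v w) (apply-+ʳ a v w)

    action : Action 𝕄 𝕍
    action = record
      { _▹_  = apply
      ; ▹-+ˡ = λ a b v → Linear.+-homo (map-linear (dot-linearˡ v) n) a b
      ; ▹-·ˡ = λ c a v → Linear.·-homo (map-linear (dot-linearˡ v) n) c a
      ; ▹-+ʳ = apply-+ʳ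
      ; ▹-·ʳ = λ a c v → trans (Vec.map-cong (λ r → Linear.·-homo (dot-linearʳ r) c v) a) (Vec.map-∘ (c F.*_) (λ r → dot r v) a)
      }

    open Action action using (_▹_)

    infixl 7 _∙_
    _∙_ : ∣ 𝕄 ∣ → ∣ 𝕄 ∣ → ∣ 𝕄 ∣
    a ∙ b = Vec.map (λ r → combine 𝕍 r b) a

    -- Instead of exchanging a double sum, the linear form given by pairing with v is moved through
    -- the combination of the rows of b.
    ∙-▹ : ∀ a b v → (a ∙ b) ▹ v ≡ a ▹ b ▹ v
    ∙-▹ a b v = trans (sym (Vec.map-∘ _ _ a)) (Vec.map-cong (λ r → combine-homo (dot-linearˡ v) r b) a)

    identity : ∀ n → Vec (Vec (Fin q) n) n
    identity zero    = []
    identity (suc n) = (F.1# ∷ Vec.replicate n F.0#) ∷ Vec.map (F.0# ∷_) (identity n)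

    apply-0∷ : ∀ {k l} (a : Vec (Vec (Fin q) k) l) x v → apply (Vec.map (F.0# ∷_) a) (x ∷ v) ≡ apply a v
    apply-0∷ a x v = trans (sym (Vec.map-∘ _ _ a))
      (Vec.map-cong (λ r → trans (cong (F._+ dot r v) (F.zeroˡ x)) (F.+-identityˡ (dot r v))) a)

    identity-▹ : ∀ {n} (v : Vec (Fin q) n) → apply (identity n) v ≡ v
    identity-▹ []      = refl
    identity-▹ {suc n} (x ∷ v) = cong₂ _∷_
      (trans (cong₂ F._+_ (F.*-identityˡ x) (Combination.combine-0ˡ 𝔽 v)) (F.+-identityʳ x))
      (trans (apply-0∷ (identity n) x v) (identity-▹ v))

    dot-nondegenerate : ∀ {n} (r : Vec (Fin q) n) → (∀ v → dot r v ≡ F.0#) → r ≡ Vec.replicate n F.0#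
    dot-nondegenerate [] _ = refl
    dot-nondegenerate {suc n} (x ∷ r) r⊥ = cong₂ _∷_
      (trans (sym (trans (cong₂ F._+_ (F.*-identityʳ x) (Linear.0-homo (dot-linearʳ r))) (F.+-identityʳ x)))
             (r⊥ (F.1# ∷ Vec.replicate n F.0#)))
      (dot-nondegenerate r λ v → trans (sym (trans (cong (F._+ dot r v) (F.zeroʳ x)) (F.+-identityˡ _))) (r⊥ (F.0# ∷ v)))

    -- Makes the annihilator of the whole space trivial, so that a bound on A / N becomes a bound on
    -- A.
    faithful : ∀ {k l} (a : Vec (Vec (Fin q) k) l) → (∀ v → apply a v ≡ Vec.replicate l F.0#) →
               a ≡ Vec.replicate l (Vec.replicate k F.0#)
    faithful []      _  = refl
    faithful (r ∷ a) a0 = cong₂ _∷_ (dot-nondegenerate r λ v → Vec.∷-injectiveˡ (a0 v))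
                                    (faithful a λ v → Vec.∷-injectiveʳ (a0 v))

    Commute : ∣ 𝕄 ∣ → ∣ 𝕄 ∣ → Set
    Commute a b = ∀ v → a ▹ b ▹ v ≡ b ▹ a ▹ v

    commute? : ∀ a b → Dec (Commute a b)
    commute? a b = Space.all∀? 𝕍 λ v → Space._≟_ 𝕍 (a ▹ b ▹ v) (b ▹ a ▹ v)

    centralizer : List ∣ 𝕄 ∣ → Subspace 𝕄
    centralizer s = record
      { _∋_     = λ a → All (Commute a) s
      ; _∋?_    = λ a → All.all? (commute? a) s
      ; ∋-0     = All.universal (λ b v → trans (Linear.0-homo (eval (b ▹ v)))
                    (sym (trans (cong (b ▹_) (Linear.0-homo (eval v))) (Linear.0-homo (act b))))) s
      ; ∋-minus = λ a a′ → All.zipWith (λ { {b} (p , p′) v → trans (Linear.minus-homo (eval (b ▹ v)) _ _)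
                    (trans (cong₂ _-_ (p v) (p′ v))
                    (trans (sym (Linear.minus-homo (act b) _ _)) (cong (b ▹_) (sym (Linear.minus-homo (eval v) _ _))))) }) (a , a′)
      ; ∋-·     = λ c → All.map λ {b} p v → trans (Linear.·-homo (eval (b ▹ v)) c _)
                    (trans (cong (c ·_) (p v))
                    (trans (sym (Linear.·-homo (act b) c _)) (cong (b ▹_) (sym (Linear.·-homo (eval v) c _)))))
      }
      where
      open Action action using (eval; act)
      open Space 𝕍

    Abelian : List ∣ 𝕄 ∣ → Set
    Abelian s = ∀ a → centralizer s ∋ a → ∀ b → centralizer s ∋ b → Commute a b

    abelian? : ∀ s → Dec (Abelian s)
    abelian? s = Space.all∀? 𝕄 λ a → (centralizer s ∋? a) →-dec
                 Space.all∀? 𝕄 λ b → (centralizer s ∋? b) →-dec commute? a b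

    centralizer-algebra : ∀ s → Abelian s → IsCommutativeAlgebra action (centralizer s)
    centralizer-algebra s abelian = record
      { commute = λ a∈ b∈ → abelian _ a∈ _ b∈
      ; product = λ {a} {b} a∈ b∈ → a ∙ b , All.zipWith (λ {c} (p , p′) → ∙-commute a b c p p′) (a∈ , b∈) , ∙-▹ a b
      ; unit    = identity n ,
                  All.universal (λ b v → trans (identity-▹ (b ▹ v)) (cong (b ▹_) (sym (identity-▹ v)))) s ,
                  identity-▹
      }
      where
      open ≡-Reasoning
      ∙-commute : ∀ a b c → Commute a c → Commute b c → Commute (a ∙ b) c
      ∙-commute a b c ac≡ca bc≡cb v = begin
        (a ∙ b) ▹ c ▹ v    ≡⟨ ∙-▹ a b (c ▹ v) ⟩
        a ▹ b ▹ c ▹ v      ≡⟨ cong (a ▹_) (bc≡cb v) ⟩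
        a ▹ c ▹ b ▹ v      ≡⟨ ac≡ca (b ▹ v) ⟩
        c ▹ a ▹ b ▹ v      ≡⟨ cong (c ▹_) (∙-▹ a b v) ⟨
        c ▹ (a ∙ b) ▹ v    ∎

    -- Schur's bound for S = 0 and T the whole space, with d = n.
    size-abelian : ∀ s → Abelian s → size (centralizer s) ℕ.≤ q ^ m n
    size-abelian s abelian = begin
      size A                                    ≤⟨ schur n 0-subspace full
                                                     (λ { {a} _ refl → Linear.0-homo (Action.act action a) }) (λ _ _ → tt) (λ _ _ → tt) full≤ ⟩
      size (colon A 0-subspace full) * q ^ m n  ≤⟨ ℕ.*-monoˡ-≤ (q ^ m n) (size-0 (colon A 0-subspace full)
                                                     λ a (_ , a0) → faithful a λ v → a0 v tt) ⟩
      1 * q ^ m n                               ≡⟨ ℕ.*-identityˡ _ ⟩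
      q ^ m n                                   ∎
      where
      open ℕ.≤-Reasoning
      A = centralizer s
      open Schur action A (centralizer-algebra s abelian)
      full≤ : size (full {𝕍}) ℕ.≤ size (0-subspace {𝕍}) * q ^ n
      full≤ = begin
        size (full {𝕍})
          ≡⟨ trans (size-full {𝕍}) (trans (length-vectors n (allFin q)) (cong (_^ n) (List.length-tabulate {n = q} id))) ⟩
        q ^ n
          ≤⟨ ℕ.m≤n*m (q ^ n) (size (0-subspace {𝕍})) {{ℕ.>-nonZero (size-positive (0-subspace {𝕍}))}} ⟩
        size (0-subspace {𝕍}) * q ^ n  ∎

    -- Matrices as functions and as vectors; the upper bound

    toVec : Matrix q n → ∣ 𝕄 ∣
    toVec A = Vec.tabulate (Vec.tabulate ∘ A)

    -- Both enumerations list the matrices in the same order, so counts are transferred by rewriting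
    -- the list.
    map-toVec : map toVec (allMatrices q n) ≡ Space.elements 𝕄
    map-toVec = trans (map-tabulate-allFuns Vec.tabulate n (allFuns n (allFin q)))
      (cong (vectors n) (trans (map-tabulate-allFuns id n (allFin q)) (cong (vectors n) (List.map-id (allFin q)))))

    zipWith-tabulate : ∀ {k} (_⊛_ : Fin q → Fin q → Fin q) (f g : Fin k → Fin q) →
                       Vec.zipWith _⊛_ (Vec.tabulate f) (Vec.tabulate g) ≡ Vec.tabulate (λ i → f i ⊛ g i)
    zipWith-tabulate {zero}  _⊛_ f g = refl
    zipWith-tabulate {suc k} _⊛_ f g = cong (f zero ⊛ g zero ∷_) (zipWith-tabulate _⊛_ (f ∘ suc) (g ∘ suc))

    tabulate-const : ∀ k (x : Fin q) → Vec.replicate k x ≡ Vec.tabulate (λ _ → x)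
    tabulate-const zero    x = refl
    tabulate-const (suc k) x = cong (x ∷_) (tabulate-const k x)

    combine-tabulate : ∀ {k} (x : Fin k → Fin q) (B : Fin k → Fin n → Fin q) →
      combine 𝕍 (Vec.tabulate x) (Vec.tabulate (Vec.tabulate ∘ B)) ≡
      Vec.tabulate (λ j → sumF F (λ l → x l F.* B l j))
    combine-tabulate {zero}  x B = tabulate-const n F.0#
    combine-tabulate {suc k} x B = trans
      (cong₂ (Vec.zipWith F._+_) (sym (Vec.tabulate-∘ (x zero F.*_) (B zero))) (combine-tabulate (x ∘ suc) (B ∘ suc)))
      (zipWith-tabulate F._+_ _ _)

    ∙-toVec : ∀ A B → toVec A ∙ toVec B ≡ toVec (mulM F A B)
    ∙-toVec A B = trans (sym (Vec.tabulate-∘ _ _)) (Vec.tabulate-cong λ i → combine-tabulate (A i) B)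

    toVec-commute : ∀ A B → (∀ i j → mulM F A B i j ≡ mulM F B A i j) → Commute (toVec A) (toVec B)
    toVec-commute A B AB≡BA v = begin
      toVec A ▹ toVec B ▹ v    ≡⟨ ∙-▹ (toVec A) (toVec B) v ⟨
      (toVec A ∙ toVec B) ▹ v  ≡⟨ cong (_▹ v) (trans (∙-toVec A B)
                                    (trans (Vec.tabulate-cong λ i → Vec.tabulate-cong (AB≡BA i)) (sym (∙-toVec B A)))) ⟩
      (toVec B ∙ toVec A) ▹ v  ≡⟨ ∙-▹ (toVec B) (toVec A) v ⟩
      toVec B ▹ toVec A ▹ v    ∎
      where open ≡-Reasoning

    length-filter-toVec : ∀ {P : ∣ 𝕄 ∣ → Set} (P? : Decidable P) →
                          length (filter (P? ∘ toVec) (allMatrices q n)) ≡ Space.count 𝕄 P?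
    length-filter-toVec P? = trans (sym (length-filter-map toVec P? (allMatrices q n)))
                                   (cong (length ∘ filter P?) map-toVec)

    -- The first condition does not involve X: it empties the set when the centralizer of s is not
    -- commutative, so the union bound may run over all s.
    Good : List ∣ 𝕄 ∣ → Matrix q n → Set
    Good s X = Abelian s × centralizer s ∋ toVec X

    good? : ∀ s → Decidable (Good s)
    good? s X = abelian? s ×-dec (centralizer s ∋? toVec X)

    length-good : ∀ s → length (filter (good? s) (allMatrices q n)) ℕ.≤ q ^ m n
    length-good s = go (abelian? s)
      where
      open ℕ.≤-Reasoning
      go : Dec (Abelian s) → length (filter (good? s) (allMatrices q n)) ℕ.≤ q ^ m n
      go (yes abelian) = begin
        length (filter (good? s) (allMatrices q n))
          ≤⟨ length-filter-mono (good? s) ((centralizer s ∋?_) ∘ toVec) (λ _ → proj₂) (allMatrices q n) ⟩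
        length (filter ((centralizer s ∋?_) ∘ toVec) (allMatrices q n))
          ≡⟨ length-filter-toVec (centralizer s ∋?_) ⟩
        size (centralizer s)
          ≤⟨ size-abelian s abelian ⟩
        q ^ m n
          ∎
      go (no ¬abelian) = begin
        length (filter (good? s) (allMatrices q n))
          ≡⟨ cong length (List.filter-none (good? s) (All.universal (λ _ → ¬abelian ∘ proj₁) (allMatrices q n))) ⟩
        0
          ≤⟨ z≤n ⟩
        q ^ m n
          ∎

    -- The witness is the list of all matrices commuting with the tuple; its centralizer
    -- is the double centralizer of the tuple.
    commuting⇒good : ∀ {k} (t : Fin k → Matrix q n) → PairwiseCommuting F t →
                     Any (λ s → ∀ i → Good s (t i)) (sublists (Space.elements 𝕄))
    commuting⇒good {k} t commuting = lose (filter∈sublists t′? (Space.elements 𝕄)) λ i → abelian , t∈ i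
      where
      t′? : Decidable λ b → ∀ i → Commute (toVec (t i)) b
      t′? b = Fin.all? λ i → commute? (toVec (t i)) b
      s = filter t′? (Space.elements 𝕄)
      t∈ : ∀ i → centralizer s ∋ toVec (t i)
      t∈ i = All.tabulate λ b∈ → proj₂ (∈-filter⁻ t′? {xs = Space.elements 𝕄} b∈) i
      t∈s : ∀ i → toVec (t i) ∈ s
      t∈s i = ∈-filter⁺ t′? (Space.complete 𝕄 _) λ j → toVec-commute (t j) (t i) (commuting j i)
      -- An a commuting with all of s commutes in particular with each `t i`, hence lies in s
      -- itself; and b commutes with every member of s.
      abelian : Abelian s
      abelian a a∈ b b∈ v = sym (All.lookup b∈
        (∈-filter⁺ t′? (Space.complete 𝕄 a) λ i v → sym (All.lookup a∈ (t∈s i) v)) v)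

    -- The constant is the number of sets of matrices. For each set s the tuples in question have
    -- all their entries in one algebra with at most `q ^ m n` elements.
    C-upper : ∀ k → C F n k ℕ.≤ length (sublists (Space.elements 𝕄)) * q ^ (m n * k)
    C-upper k = begin
      C F n k
        ≤⟨ length-filter-mono _ (λ t → any? (λ s → goods? s t) ss) commuting⇒good tuples ⟩
      length (filter (λ t → any? (λ s → goods? s t) ss) tuples)
        ≤⟨ length-filter-⋃ goods? tuples goods≤ ss ⟩
      length ss * q ^ (m n * k)
        ∎
      where
      open ℕ.≤-Reasoning
      ss = sublists (Space.elements 𝕄)
      tuples = allFuns k (allMatrices q n)
      goods? : ∀ s → Decidable (λ (t : Fin k → Matrix q n) → ∀ i → Good s (t i))
      goods? s t = Fin.all? λ i → good? s (t i)
      goods≤ : ∀ s → length (filter (goods? s) tuples) ℕ.≤ q ^ (m n * k)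
      goods≤ s = begin
        length (filter (goods? s) tuples)                 ≡⟨ length-filter-allFuns (good? s) k (allMatrices q n) ⟩
        length (filter (good? s) (allMatrices q n)) ^ k   ≤⟨ ℕ.^-monoˡ-≤ k (length-good s) ⟩
        (q ^ m n) ^ k                                     ≡⟨ ℕ.^-*-assoc q (m n) k ⟩
        q ^ (m n * k)                                     ∎

  -- The lower bound

  sumF-+ : ∀ {n} (f g : Fin n → Fin q) → sumF F (λ i → f i F.+ g i) ≡ sumF F f F.+ sumF F g
  sumF-+ {zero}  f g = sym (F.+-identityˡ F.0#)
  sumF-+ {suc n} f g = trans (cong (f zero F.+ g zero F.+_) (sumF-+ (f ∘ suc) (g ∘ suc))) (Space.interchange 𝔽 _ _ _ _)

  sumF-cong : ∀ {n} {f g : Fin n → Fin q} → (∀ i → f i ≡ g i) → sumF F f ≡ sumF F g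
  sumF-cong {zero}  eq = refl
  sumF-cong {suc n} eq = cong₂ F._+_ (eq zero) (sumF-cong (eq ∘ suc))

  sumF-0 : ∀ {n} {f : Fin n → Fin q} → (∀ i → f i ≡ F.0#) → sumF F f ≡ F.0#
  sumF-0 {zero}  eq = refl
  sumF-0 {suc n} eq = trans (cong₂ F._+_ (eq zero) (sumF-0 (eq ∘ suc))) (F.+-identityˡ F.0#)

  δ : ∀ {n} → Fin n → Fin n → Fin q
  δ zero    zero    = F.1#
  δ zero    (suc j) = F.0#
  δ (suc i) zero    = F.0#
  δ (suc i) (suc j) = δ i j

  δ-diagonal : ∀ {n} (i : Fin n) → δ i i ≡ F.1#
  δ-diagonal zero    = refl
  δ-diagonal (suc i) = δ-diagonal i

  δ-sym : ∀ {n} (i j : Fin n) → δ i j ≡ δ j i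
  δ-sym zero    zero    = refl
  δ-sym zero    (suc j) = refl
  δ-sym (suc i) zero    = refl
  δ-sym (suc i) (suc j) = δ-sym i j

  c0x : ∀ c x → c F.* F.0# F.* x ≡ F.0#
  c0x c x = trans (cong (F._* x) (F.zeroʳ c)) (F.zeroˡ x)

  sumF-δ : ∀ {n} c (i : Fin n) (f : Fin n → Fin q) → sumF F (λ l → c F.* δ i l F.* f l) ≡ c F.* f i
  sumF-δ c zero    f = trans (cong₂ F._+_ (cong (F._* f zero) (F.*-identityʳ c)) (sumF-0 λ l → c0x c (f (suc l))))
                             (F.+-identityʳ _)
  sumF-δ c (suc i) f = trans (cong₂ F._+_ (c0x c (f zero)) (sumF-δ c i (f ∘ suc))) (F.+-identityˡ _)

  module Block (h r : ℕ) where
    private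
      n = h ℕ.+ r
      open Matrices n using (𝕄; toVec)

    Upper : Fin n → Set
    Upper i = Is-inj₁ (Fin.splitAt h i)
      where
      Is-inj₁ : Fin h ⊎ Fin r → Set
      Is-inj₁ (inj₁ _) = ⊤
      Is-inj₁ (inj₂ _) = ⊥

    upper? : Decidable Upper
    upper? i with Fin.splitAt h i
    ... | inj₁ _ = yes tt
    ... | inj₂ _ = no id

    -- The matrices cI + B: the entries of the upper right block are left free, and all others must
    -- agree with cI.
    ScalarPlusBlock : (Fin n → Fin n → Fin q) → Set
    ScalarPlusBlock X = ∃ λ c → ∀ i j → (Upper i × ¬ Upper j) ⊎ X i j ≡ c F.* δ i j

    scalarPlusBlock? : Decidable ScalarPlusBlock
    scalarPlusBlock? X = Fin.any? λ c → Fin.all? λ i → Fin.all? λ j →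
      (upper? i ×-dec ¬? (upper? j)) ⊎-dec (X i j Fin.≟ c F.* δ i j)

    -- For X = c I + B and Y = d I + B′ this is B B′ = 0 entrywise, arranged so that no subtraction occurs.
    product-term : ∀ {X Y} ((c , _) : ScalarPlusBlock X) ((d , _) : ScalarPlusBlock Y) i l j →
      X i l F.* Y l j F.+ c F.* δ i l F.* (d F.* δ l j) ≡
      c F.* δ i l F.* Y l j F.+ d F.* δ j l F.* X i l
    product-term {X} {Y} (c , X-block) (d , Y-block) i l j with X-block i l | Y-block l j
    ... | inj₂ eq | _ rewrite eq | δ-sym j l = cong₂ F._+_ refl (F.*-comm _ _)
    ... | inj₁ _  | inj₂ eq rewrite eq | δ-sym j l = trans (F.+-comm _ _) (cong₂ F._+_ refl (F.*-comm _ _))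
    -- Only here could BB′ contribute, but l would lie outside `Upper` as a column of B and inside
    -- it as a row of B′.
    ... | inj₁ (_ , ¬u) | inj₁ (u , _) = contradiction u ¬u

    -- This is XY = cY + dX - cdI with the last term moved to the left. The formula is symmetric in
    -- X and Y, from which `commute` follows by cancellation.
    product : ∀ {X Y} ((c , _) : ScalarPlusBlock X) ((d , _) : ScalarPlusBlock Y) i j →
      mulM F X Y i j F.+ c F.* (d F.* δ i j) ≡ c F.* Y i j F.+ d F.* X i j
    product {X} {Y} bX@(c , _) bY@(d , _) i j = begin
      mulM F X Y i j F.+ c F.* (d F.* δ i j)
        ≡⟨ cong (mulM F X Y i j F.+_) (sumF-δ c i (λ l → d F.* δ l j)) ⟨
      mulM F X Y i j F.+ sumF F (λ l → c F.* δ i l F.* (d F.* δ l j))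
        ≡⟨ sumF-+ {n} _ _ ⟨
      sumF F (λ l → X i l F.* Y l j F.+ c F.* δ i l F.* (d F.* δ l j))
        ≡⟨ sumF-cong (λ l → product-term {X} {Y} bX bY i l j) ⟩
      sumF F (λ l → c F.* δ i l F.* Y l j F.+ d F.* δ j l F.* X i l)
        ≡⟨ sumF-+ {n} _ _ ⟩
      sumF F (λ l → c F.* δ i l F.* Y l j) F.+ sumF F (λ l → d F.* δ j l F.* X i l)
        ≡⟨ cong₂ F._+_ (sumF-δ c i (λ l → Y l j)) (sumF-δ d j (X i)) ⟩
      c F.* Y i j F.+ d F.* X i j
        ∎
      where open ≡-Reasoning

    commute : ∀ {X Y} → ScalarPlusBlock X → ScalarPlusBlock Y → ∀ i j → mulM F X Y i j ≡ mulM F Y X i j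
    commute {X} {Y} bX@(c , _) bY@(d , _) i j = Space.+-cancelˡ 𝔽 (c F.* (d F.* δ i j)) _ _ (begin
      c F.* (d F.* δ i j) F.+ mulM F X Y i j  ≡⟨ F.+-comm _ _ ⟩
      mulM F X Y i j F.+ c F.* (d F.* δ i j)  ≡⟨ product {X} {Y} bX bY i j ⟩
      c F.* Y i j F.+ d F.* X i j             ≡⟨ F.+-comm _ _ ⟩
      d F.* X i j F.+ c F.* Y i j             ≡⟨ product {Y} {X} bY bX i j ⟨
      mulM F Y X i j F.+ d F.* (c F.* δ i j)  ≡⟨ cong (mulM F Y X i j F.+_) (trans (sym (F.*-assoc d c _))
                                                   (trans (cong (F._* δ i j) (F.*-comm d c)) (F.*-assoc c d _))) ⟩
      mulM F Y X i j F.+ c F.* (d F.* δ i j)  ≡⟨ F.+-comm _ _ ⟩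
      c F.* (d F.* δ i j) F.+ mulM F Y X i j  ∎)
      where open ≡-Reasoning

    entry : Fin q × Vec (Vec (Fin q) r) h → Fin n → Fin n → Fin q
    entry (c , b) i j with Fin.splitAt h i | Fin.splitAt h j
    ... | inj₁ i′ | inj₂ j′ = Vec.lookup (Vec.lookup b i′) j′
    ... | inj₁ _  | inj₁ _  = c F.* δ i j
    ... | inj₂ _  | _       = c F.* δ i j

    entry-block : ∀ cb → ScalarPlusBlock (entry cb)
    entry-block (c , b) = c , block
      where
      block : ∀ i j → (Upper i × ¬ Upper j) ⊎ entry (c , b) i j ≡ c F.* δ i j
      block i j with Fin.splitAt h i | Fin.splitAt h j
      ... | inj₁ _ | inj₂ _ = inj₁ (tt , id)
      ... | inj₁ _ | inj₁ _ = inj₂ refl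
      ... | inj₂ _ | _      = inj₂ refl

    entry-diagonal : ∀ cb i → entry cb i i ≡ proj₁ cb
    entry-diagonal (c , b) i with Fin.splitAt h i
    ... | inj₁ _ = trans (cong (c F.*_) (δ-diagonal i)) (F.*-identityʳ c)
    ... | inj₂ _ = trans (cong (c F.*_) (δ-diagonal i)) (F.*-identityʳ c)

    entry-↑ : ∀ c b i j → entry (c , b) (i Fin.↑ˡ r) (h Fin.↑ʳ j) ≡ Vec.lookup (Vec.lookup b i) j
    entry-↑ c b i j rewrite Fin.splitAt-↑ˡ h i r | Fin.splitAt-↑ʳ h r j = refl

    lookup-ext : ∀ {A : Set} {k} (v w : Vec A k) → (∀ i → Vec.lookup v i ≡ Vec.lookup w i) → v ≡ w
    lookup-ext v w eq = trans (sym (Vec.tabulate∘lookup v)) (trans (Vec.tabulate-cong eq) (Vec.tabulate∘lookup w))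

    -- An index is taken because c is read off from a diagonal entry; for n = 0 all scalars give the
    -- same empty matrix. This is where the lower bound uses that n is positive.
    entry-injective : Fin n → ∀ {cb cb′} → (∀ i j → entry cb i j ≡ entry cb′ i j) → cb ≡ cb′
    entry-injective i {c , b} {c′ , b′} eq = cong₂ _,_
      (trans (sym (entry-diagonal (c , b) i)) (trans (eq i i) (entry-diagonal (c′ , b′) i)))
      (lookup-ext b b′ λ i → lookup-ext _ _ λ j →
        trans (sym (entry-↑ c b i j)) (trans (eq _ _) (entry-↑ c′ b′ i j)))

    lookup-toVec : ∀ X i j → Vec.lookup (Vec.lookup (toVec X) i) j ≡ X i j
    lookup-toVec X i j = trans (cong (λ v → Vec.lookup v j) (Vec.lookup∘tabulate (Vec.tabulate ∘ X) i))
                               (Vec.lookup∘tabulate (X i) j)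

    toVec-injective : ∀ {X Y} → toVec X ≡ toVec Y → ∀ i j → X i j ≡ Y i j
    toVec-injective {X} {Y} eq i j = trans (sym (lookup-toVec X i j))
      (trans (cong (λ a → Vec.lookup (Vec.lookup a i) j) eq) (lookup-toVec Y i j))

    length-scalarPlusBlock : Fin n → q ^ suc (h * r) ℕ.≤ length (filter scalarPlusBlock? (allMatrices q n))
    length-scalarPlusBlock i₀ = begin
      q * q ^ (h * r)             ≡⟨ cong (λ e → q * q ^ e) (ℕ.*-comm h r) ⟩
      q * q ^ (r * h)             ≡⟨ cong (q *_) (ℕ.^-*-assoc q r h) ⟨
      q * (q ^ r) ^ h             ≡⟨ cong₂ (λ x y → x * (y ^ r) ^ h) length-F length-F ⟨
      length Fs * (length Fs ^ r) ^ h
                                  ≡⟨ cong (λ x → length Fs * x ^ h) (length-vectors r Fs) ⟨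
      length Fs * length (vectors r Fs) ^ h
                                  ≡⟨ cong (length Fs *_) (length-vectors h (vectors r Fs)) ⟨
      length Fs * length Bs       ≡⟨ length-cartesianProductWith _,_ Fs Bs ⟨
      length (cartesianProduct Fs Bs)
                                  ≤⟨ injection⇒length≤ (toVec ∘ entry)
                                       (Unique.cartesianProduct⁺ (Unique.allFin⁺ q) (vectors-unique h (vectors-unique r (Unique.allFin⁺ q))))
                                       (λ {cb} _ → toVec∈ cb)
                                       (λ {cb} {cb′} _ _ eq → entry-injective i₀ (toVec-injective {entry cb} {entry cb′} eq)) ⟩
      length (filter P? (map toVec (allMatrices q n)))
                                  ≡⟨ length-filter-map toVec P? (allMatrices q n) ⟩
      length (filter (P? ∘ toVec) (allMatrices q n))
                                  ≤⟨ length-filter-mono (P? ∘ toVec) scalarPlusBlock? back (allMatrices q n) ⟩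
      length (filter scalarPlusBlock? (allMatrices q n))
                                  ∎
      where
      open ℕ.≤-Reasoning
      Fs = allFin q
      Bs = vectors h (vectors r Fs)
      length-F : length Fs ≡ q
      length-F = List.length-tabulate {n = q} id
      -- Membership in a list of functions would call for equality of functions, so the predicate is
      -- moved to vectors and the images are found there.
      P : ∣ 𝕄 ∣ → Set
      P a = ScalarPlusBlock (λ i j → Vec.lookup (Vec.lookup a i) j)
      P? : Decidable P
      P? a = scalarPlusBlock? _
      back : ∀ X → P (toVec X) → ScalarPlusBlock X
      back X (c , block) = c , λ i j → Sum.map₂ (trans (sym (lookup-toVec X i j))) (block i j)
      forth : ∀ X → ScalarPlusBlock X → P (toVec X)
      forth X (c , block) = c , λ i j → Sum.map₂ (trans (lookup-toVec X i j)) (block i j)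
      toVec∈ : ∀ cb → toVec (entry cb) ∈ filter P? (map toVec (allMatrices q n))
      toVec∈ cb = ∈-filter⁺ P? (subst (toVec (entry cb) ∈_) (sym (Matrices.map-toVec n)) (Space.complete 𝕄 _))
                               (forth (entry cb) (entry-block cb))

    C-block : Fin n → ∀ k → q ^ (suc (h * r) * k) ℕ.≤ C F n k
    C-block i₀ k = begin
      q ^ (suc (h * r) * k)  ≡⟨ ℕ.^-*-assoc q (suc (h * r)) k ⟨
      (q ^ suc (h * r)) ^ k  ≤⟨ ℕ.^-monoˡ-≤ k (length-scalarPlusBlock i₀) ⟩
      length (filter scalarPlusBlock? (allMatrices q n)) ^ k
                             ≡⟨ length-filter-allFuns scalarPlusBlock? k (allMatrices q n) ⟨
      length (filter (λ t → Fin.all? (λ i → scalarPlusBlock? (t i))) (allFuns k (allMatrices q n)))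
                             ≤⟨ length-filter-mono _ (pairwiseCommuting? F) (λ t b i j → commute (b i) (b j)) (allFuns k (allMatrices q n)) ⟩
      C F n k                ∎
      where open ℕ.≤-Reasoning

  -- The block has h rows and h or h + 1 columns according to the parity of n, which gives `m n`
  -- free parameters together with the scalar. Positivity of n supplies the index `zero`.
  C-lower : ∀ n → .{{NonZero n}} → ∀ k → q ^ (m n * k) ℕ.≤ C F n k
  C-lower n k with halves n
  C-lower (suc n) k | h , inj₁ eq = subst (λ n → Fin n → q ^ (m n * k) ℕ.≤ C F n k) (sym eq)
    (subst (λ e → Fin (h ℕ.+ h) → q ^ (e * k) ℕ.≤ C F (h ℕ.+ h) k) (sym (m-even h)) λ i → Block.C-block h h i k) zero
  C-lower (suc n) k | h , inj₂ eq = subst (λ n → Fin n → q ^ (m n * k) ℕ.≤ C F n k) (sym eq)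
    (subst (λ e → Fin (h ℕ.+ suc h) → q ^ (e * k) ℕ.≤ C F (h ℕ.+ suc h) k) (sym (m-odd h)) λ i → Block.C-block h (suc h) i k) zero

-- Passage to rational constants

open import Data.Integer using (+_)
open import Data.Rational using (ℚ; Positive; _≤_; _/_; toℚᵘ)
open import Data.Rational using () renaming (_*_ to _*ℚ_)
import Data.Integer.Base as ℤ
import Data.Integer.Properties as ℤ
import Data.Rational.Properties as ℚ
open import Data.Rational.Unnormalised.Base as ℚᵘ using (mkℚᵘ)
import Data.Rational.Unnormalised.Properties as ℚᵘ

-- The comparison is made on unnormalised fractions, where numerator and denominator are explicit.
/1-mono-≤ : ∀ {a b} → a ℕ.≤ b → (+ a) / 1 ≤ (+ b) / 1
/1-mono-≤ {a} {b} a≤b = ℚ.toℚᵘ-cancel-≤ (begin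
  toℚᵘ ((+ a) / 1)  ≃⟨ ℚ.toℚᵘ-fromℚᵘ (mkℚᵘ (+ a) 0) ⟩
  mkℚᵘ (+ a) 0        ≤⟨ ℚᵘ.*≤* (ℤ.*-monoʳ-≤-nonNeg (+ 1) (ℤ.+≤+ a≤b)) ⟩
  mkℚᵘ (+ b) 0        ≃⟨ ℚ.toℚᵘ-fromℚᵘ (mkℚᵘ (+ b) 0) ⟨
  toℚᵘ ((+ b) / 1)  ∎)
  where open ℚᵘ.≤-Reasoning

/1-homo-* : ∀ a b → (+ (a * b)) / 1 ≡ ((+ a) / 1) *ℚ ((+ b) / 1)
/1-homo-* a b = ℚ.toℚᵘ-injective (begin-equality
  toℚᵘ ((+ (a * b)) / 1)                        ≃⟨ ℚ.toℚᵘ-fromℚᵘ (mkℚᵘ (+ (a * b)) 0) ⟩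
  mkℚᵘ (+ (a * b)) 0                              ≡⟨ cong (λ z → mkℚᵘ z 0) (ℤ.pos-* a b) ⟩
  mkℚᵘ (+ a) 0 ℚᵘ.* mkℚᵘ (+ b) 0                  ≃⟨ ℚᵘ.*-cong (ℚ.toℚᵘ-fromℚᵘ (mkℚᵘ (+ a) 0)) (ℚ.toℚᵘ-fromℚᵘ (mkℚᵘ (+ b) 0)) ⟨
  toℚᵘ ((+ a) / 1) ℚᵘ.* toℚᵘ ((+ b) / 1)      ≃⟨ ℚ.toℚᵘ-homo-* ((+ a) / 1) ((+ b) / 1) ⟨
  toℚᵘ (((+ a) / 1) *ℚ ((+ b) / 1))                 ∎)
  where open ℚᵘ.≤-Reasoning

theorem2 : (n q : ℕ) → .{{_ : NonZero n}} → IsPrimePower q → (F : FiniteField q) →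
    ∃ λ (D₁ : ℚ) → ∃ λ (D₂ : ℚ) → Positive D₁ × Positive D₂ ×
    ∃ λ (K : ℕ) → ∀ k → k ≥ K →
    (D₁ *ℚ ((+ (q ^ (m n * k))) / 1) ≤ (+ C F n k) / 1)
    × ((+ C F n k) / 1 ≤ D₂ *ℚ ((+ (q ^ (m n * k))) / 1))
-- Both bounds hold from k = 0 on. The lower constant is 1, and the upper one is `suc L` rather than
-- `L`, so that its positivity is immediate.
theorem2 n q _ F = (+ 1) / 1 , (+ suc L) / 1 , ℚ.normalize-pos 1 1 , ℚ.normalize-pos (suc L) 1 , 0 , λ k _ →
  ( subst (_≤ (+ C F n k) / 1) (sym (ℚ.*-identityˡ ((+ Q k) / 1))) (/1-mono-≤ {Q k} {C F n k} (C-lower n k))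
  , subst ((+ C F n k) / 1 ≤_) (/1-homo-* (suc L) (Q k))
      (/1-mono-≤ {C F n k} {suc L * Q k} (ℕ.≤-trans (Matrices.C-upper n k) (ℕ.m≤n+m _ (Q k)))))
  where
  open LinearAlgebra F
  Q : ℕ → ℕ
  Q k = q ^ (m n * k)
  L = length (sublists (Space.elements (Matrices.𝕄 n)))
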